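{- Let $\Gamma=(G,\sigma)$ be a signed graph, let $u,v$ be two distinct vertices of $\Gamma$, let $vv_1,\dots,vv_s$ ($s\ge 1$) be cut edges of $\Gamma$ such that $u\notin\{v_1,\dots,v_s\}$ and no $uv_i$ is an edge of $\Gamma$, and let $\mathbf x$ be an eigenvector of $A(\Gamma)$ corresponding to the index $\lambda(\Gamma)$. Let $$\Gamma'=\Gamma-vv_1-\cdots-vv_s+uv_1+\cdots+uv_s,$$ where each new edge $uv_i$ has the sign $\sigma(vv_i)$. If $x_u\ge x_v\ge 0$ or $x_u\le x_v\le 0$, then $\lambda(\Gamma')\ge\lambda(\Gamma)$.
   Context: A signed graph $\Gamma=(G,\sigma)$ is a finite simple graph $G$ with a map $\sigma:E(G)\to\{+1,-1\}$. Its adjacency matrix $A(\Gamma)$ has $(u,v)$ entry $\sigma(uv)$ if $uv\in E(G)$ and $0$ otherwise; the index $\lambda(\Gamma)$ is the largest eigenvalue of $A(\Gamma)$. For a vector $\mathbf x$ indexed by vertices, $x_u$ is its entry at $u$. A cut edge is an edge whose deletion increases the number of connected components. -}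

module Defs where

open import Algebra.Bundles using (CommutativeRing)
import Algebra.Properties.Semiring.Sum as SemiringSum
open import Data.Bool.Base using (Bool; true; false; if_then_else_; _∧_; _∨_)
open import Data.Bool.Properties using (∧-comm; ∨-comm)
open import Data.Fin.Base using (Fin; zero; suc)
open import Data.Fin.Properties using (_≟_)
open import Data.Maybe using (Maybe; just; nothing; Is-just; to-witness)
open import Data.Nat.Base using (ℕ; zero; suc; _<_)
open import Data.Product using (Σ; ∃; ∃₂; _×_)
open import Data.Sign.Base using (Sign)
open import Data.Vec.Functional using (Vector)
open import Function.Base using (_∘_)
open import Function.Bundles using (_⇔_)
open import Function.Definitions using (Surjective)
open import Level using (_⊔_) renaming (suc to lsuc)
open import Relation.Binary.Core using (Rel)
open import Relation.Binary.Construct.Closure.ReflexiveTransitive using (Star)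
open import Relation.Binary.PropositionalEquality
  using (_≡_; _≢_; refl; sym; trans; cong; cong₂)
open import Relation.Binary.Structures using (IsDecTotalOrder)
open import Relation.Nullary using (yes; no; does; contradiction)
open import Relation.Unary using (Pred)

-- The real numbers, by their classical axiomatisation: a (Dedekind-)complete
-- ordered field is unique up to unique isomorphism.  The standard library has
-- no type of reals, so statements quantify over all such structures.

record CompleteOrderedField c ℓ₁ ℓ₂ : Set (lsuc (c ⊔ ℓ₁ ⊔ ℓ₂)) where
  field
    commutativeRing : CommutativeRing c ℓ₁

  open CommutativeRing commutativeRing public
    using (Carrier; _≈_; _≉_; _+_; _*_; -_; 0#; 1#; semiring)

  infix 4 _≤_

  field
    _≤_             : Rel Carrier ℓ₂
    isDecTotalOrder : IsDecTotalOrder _≈_ _≤_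
    0≉1             : 0# ≉ 1#
    inverse         : ∀ x → x ≉ 0# → ∃ λ y → x * y ≈ 1#
    +-monoʳ-≤       : ∀ z {x y} → x ≤ y → z + x ≤ z + y
    *-nonNegative   : ∀ {x y} → 0# ≤ x → 0# ≤ y → 0# ≤ x * y

  UpperBound : ∀ {ℓ} → Pred Carrier ℓ → Pred Carrier (c ⊔ ℓ₂ ⊔ ℓ)
  UpperBound P b = ∀ x → P x → x ≤ b

  field
    supremum : (P : Pred Carrier (c ⊔ ℓ₁ ⊔ ℓ₂)) → ∃ P → ∃ (UpperBound P) →
               ∃ λ s → UpperBound P s × (∀ b → UpperBound P b → s ≤ b)

-- The graph and its signature in one function: `label a b` is `just σ(ab)` if
-- ab is an edge, and `nothing` otherwise.

record SignedGraph (n : ℕ) : Set where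
  field
    label        : Fin n → Fin n → Maybe Sign
    label-sym    : ∀ a b → label a b ≡ label b a
    label-irrefl : ∀ a → label a a ≡ nothing

open SignedGraph public

Adj : ∀ {n} → SignedGraph n → Fin n → Fin n → Set
Adj Γ a b = Is-just (label Γ a b)

sign : ∀ {n} (Γ : SignedGraph n) {a b} → Adj Γ a b → Sign
sign _ = to-witness

-- Whether {x , y} = {a , b} as unordered pairs.

samePair : ∀ {n} → Fin n → Fin n → Fin n → Fin n → Bool
samePair a b x y = (does (x ≟ a) ∧ does (y ≟ b)) ∨ (does (x ≟ b) ∧ does (y ≟ a))

samePair-sym : ∀ {n} (a b x y : Fin n) → samePair a b x y ≡ samePair a b y x
samePair-sym a b x y =
  trans (∨-comm (does (x ≟ a) ∧ does (y ≟ b)) (does (x ≟ b) ∧ does (y ≟ a)))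
        (cong₂ _∨_ (∧-comm (does (x ≟ b)) (does (y ≟ a)))
                   (∧-comm (does (x ≟ a)) (does (y ≟ b))))

samePair-loop : ∀ {n} {a b : Fin n} → a ≢ b → ∀ x → samePair a b x x ≡ false
samePair-loop {a = a} {b} a≢b x with x ≟ a | x ≟ b
... | yes x≡a | yes x≡b = contradiction (trans (sym x≡a) x≡b) a≢b
... | yes _   | no _    = refl
... | no _    | yes _   = refl
... | no _    | no _    = refl

deleteEdge : ∀ {n} → SignedGraph n → Fin n → Fin n → SignedGraph n
deleteEdge Γ a b = record
  { label        = λ x y → if samePair a b x y then nothing else label Γ x y
  ; label-sym    = λ x y → cong₂ (if_then nothing else_)
                             (samePair-sym a b x y) (label-sym Γ x y)
  ; label-irrefl = irrefl
  }
  where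
  irrefl : ∀ x → (if samePair a b x x then nothing else label Γ x x) ≡ nothing
  irrefl x with samePair a b x x
  ... | true  = refl
  ... | false = label-irrefl Γ x

addEdge : ∀ {n} → SignedGraph n → (a b : Fin n) → a ≢ b → Sign → SignedGraph n
addEdge Γ a b a≢b τ = record
  { label        = λ x y → if samePair a b x y then just τ else label Γ x y
  ; label-sym    = λ x y → cong₂ (if_then just τ else_)
                             (samePair-sym a b x y) (label-sym Γ x y)
  ; label-irrefl = λ x → trans
      (cong (if_then just τ else label Γ x x) (samePair-loop a≢b x))
      (label-irrefl Γ x)
  }

-- Γ − a w₁ − ⋯ − a wₛ

deleteStar : ∀ {n s} → SignedGraph n → Fin n → (Fin s → Fin n) → SignedGraph n
deleteStar {s = zero}  Γ a w = Γ
deleteStar {s = suc _} Γ a w = deleteStar (deleteEdge Γ a (w zero)) a (w ∘ suc)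

-- Γ + a w₁ + ⋯ + a wₛ, the edge a wᵢ having sign τ i

addStar : ∀ {n s} → SignedGraph n → (a : Fin n) (w : Fin s → Fin n) →
          (∀ i → a ≢ w i) → (Fin s → Sign) → SignedGraph n
addStar {s = zero}  Γ a w a≢w τ = Γ
addStar {s = suc _} Γ a w a≢w τ =
  addStar (addEdge Γ a (w zero) (a≢w zero) (τ zero)) a (w ∘ suc) (a≢w ∘ suc) (τ ∘ suc)

Connected : ∀ {n} → SignedGraph n → Fin n → Fin n → Set
Connected Γ = Star (Adj Γ)

-- Γ has exactly k connected components: its vertices can be labelled by Fin k,
-- using every label, with equal labels exactly on connected vertices.

HasComponents : ∀ {n} → SignedGraph n → ℕ → Set
HasComponents {n} Γ k =
  Σ (Fin n → Fin k) λ comp →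
    Surjective _≡_ _≡_ comp × (∀ a b → (comp a ≡ comp b) ⇔ Connected Γ a b)

IsCutEdge : ∀ {n} → SignedGraph n → Fin n → Fin n → Set
IsCutEdge Γ a b =
  Adj Γ a b ×
  ∃₂ λ k k′ → HasComponents Γ k × HasComponents (deleteEdge Γ a b) k′ × k < k′

-- The graph Γ − v w₁ − ⋯ − v wₛ + u w₁ + ⋯ + u wₛ, each u wᵢ inheriting the
-- sign that v wᵢ has in Γ.

moveEdges : ∀ {n s} (Γ : SignedGraph n) (u v : Fin n) (w : Fin s → Fin n) →
            (∀ i → u ≢ w i) → (∀ i → Adj Γ v (w i)) → SignedGraph n
moveEdges Γ u v w u≢w vw =
  addStar (deleteStar Γ v w) u w u≢w (λ i → sign Γ (vw i))

module Spectrum {c ℓ₁ ℓ₂} (ℝ : CompleteOrderedField c ℓ₁ ℓ₂) where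
  open CompleteOrderedField ℝ
  open SemiringSum semiring using (sum)

  Matrix : ℕ → Set c
  Matrix n = Fin n → Fin n → Carrier

  entry : Maybe Sign → Carrier
  entry nothing       = 0#
  entry (just Sign.+) = 1#
  entry (just Sign.-) = - 1#

  adjacencyMatrix : ∀ {n} → SignedGraph n → Matrix n
  adjacencyMatrix Γ a b = entry (label Γ a b)

  IsEigenvector : ∀ {n} → Matrix n → Carrier → Vector Carrier n → Set ℓ₁
  IsEigenvector M μ x =
    (∃ λ a → x a ≉ 0#) × (∀ a → sum (λ b → M a b * x b) ≈ μ * x a)

  IsEigenvalue : ∀ {n} → Matrix n → Carrier → Set (c ⊔ ℓ₁)
  IsEigenvalue M μ = ∃ λ x → IsEigenvector M μ x

  IsIndex : ∀ {n} → SignedGraph n → Carrier → Set (c ⊔ ℓ₁ ⊔ ℓ₂)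
  IsIndex Γ μ =
    IsEigenvalue (adjacencyMatrix Γ) μ ×
    (∀ ν → IsEigenvalue (adjacencyMatrix Γ) ν → ν ≤ μ)

{-# OPTIONS --safe #-}
module Submission where

-- Since index′ is the largest eigenvalue of A(Γ′), it bounds all Rayleigh
-- quotients of A(Γ′), so it suffices that xᵀA(Γ′)x ≥ xᵀA(Γ)x, that is
-- Σᵢ pᵢ (x u − x v) ≥ 0 for pᵢ = A(Γ)(v,wᵢ) x(wᵢ).  Let y be the restriction of
-- x to the component of wᵢ in Γ − v wᵢ.  Then yᵀ(index − A)y = pᵢ x v, which is
-- therefore nonnegative; and if x v = 0, then y is again a maximiser, hence an
-- eigenvector, whose equation at v says that pᵢ = 0.
--
-- The Rayleigh bound needs no spectral theorem: by taking Schur complements, a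
-- semidefinite symmetric matrix is either singular or definite.  The supremum s
-- of the Rayleigh quotients of M makes s − M semidefinite but not definite, so
-- s is an eigenvalue.

open import Defs
open import Algebra.Bundles using (CommutativeRing)
import Algebra.Properties.AbelianGroup as AbelianGroupProperties
import Algebra.Properties.Ring as RingProperties
import Algebra.Properties.Semiring.Mult.TCOptimised as SemiringMult
import Algebra.Properties.Semiring.Sum as SemiringSum
import Algebra.Solver.Ring as RingSolver
open import Algebra.Solver.Ring.AlmostCommutativeRing
  using (_-Raw-AlmostCommutative⟶_; fromCommutativeRing)
open import Data.Bool.Base using (Bool; true; false; if_then_else_; _∧_; _∨_)
open import Data.Bool.Properties using (∧-zeroʳ)
open import Data.Fin.Base using (Fin; zero; suc; punchIn; punchOut)
open import Data.Fin.Properties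
  using (_≟_; suc-injective; injective⇒≤; all?; ¬∀⟶∃¬;
         punchInᵢ≢i; punchIn-punchOut; punchOut-punchIn; punchOut-cong)
open import Data.Integer.Base as ℤ using (ℤ; +_; -[1+_]; _⊖_)
import Data.Integer.Properties as ℤ
open import Data.Maybe using (just; nothing; Is-just; to-witness)
open import Data.Maybe.Relation.Unary.Any using (just)
open import Data.Nat.Base as ℕ using (ℕ; zero; suc) renaming (_≤_ to _≤ᴺ_)
import Data.Nat.Properties as ℕ
open import Data.Product using (∃; _×_; _,_; proj₁; proj₂)
open import Data.Sum using (_⊎_; inj₁; inj₂; [_,_]′)
open import Data.Unit using (tt)
open import Data.Vec.Functional using (Vector; _∷_; head; tail)
open import Function.Base using (_∘_; _$_)
open import Function.Bundles using (Equivalence)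
open import Function.Definitions using (Injective)
open import Level using (_⊔_)
open import Relation.Binary.Construct.Closure.ReflexiveTransitive as Star using (ε; _◅_)
open import Relation.Binary.Definitions using (WeaklyDecidable)
open import Relation.Binary.PropositionalEquality as ≡ using (_≡_; _≢_)
import Relation.Binary.Reasoning.Setoid as SetoidReasoning
open import Relation.Binary.Structures using (IsDecTotalOrder)
open import Relation.Nullary using (¬_; yes; no; does; contradiction)
open import Relation.Nullary.Decidable using (decidable-stable; dec-true; dec-false)

-- For x v ≠ 0 the inequality pᵢ x v ≥ 0 fixes the sign of pᵢ, and the hypothesis on x u does the
-- rest. For x v = 0 it says nothing about pᵢ while x u may be nonzero, so pᵢ itself has to vanish.
-- Each pᵢ is studied in Γ, never in a graph with some edges already moved: for the fixed vector x
-- the quadratic form changes by one summand per edge, so no cut edge has to be followed through the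
-- intermediate graphs. That a supremum of Rayleigh quotients is attained is usually drawn from
-- compactness of the unit sphere. Elimination replaces compactness by a uniform constant δ, built
-- up over the dimension, which is why the estimates carry explicit constants. These are far from
-- sharp, since only their existence and positivity matter.

module IntegerSolver {c ℓ} (R : CommutativeRing c ℓ) where
  open CommutativeRing R
  open RingProperties ring
  open AbelianGroupProperties +-abelianGroup using (⁻¹-∙-comm)
  open SemiringMult semiring renaming (_×_ to _×′_)
  open SetoidReasoning setoid

  -- The solver compares coefficients by evaluation. Equality in an arbitrary `R` cannot be tested,
  -- whereas integers compute, so numerals and opposite terms cancel.
  fromℤ : ℤ → Carrier
  fromℤ (+ n)      = n ×′ 1#
  fromℤ (-[1+ n ]) = - (suc n ×′ 1#)

  -- Not definitional: the optimised multiple treats 1 separately so that `1 ×′ 1#` reduces to `1#`,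
  -- which is what lets `1-homo` hold by `refl`.
  suc-× : ∀ n → suc n ×′ 1# ≈ 1# + n ×′ 1#
  suc-× n = ×-homo-+ 1# 1 n

  fromℤ-⊖ : ∀ m n → fromℤ (m ⊖ n) ≈ m ×′ 1# - n ×′ 1#
  fromℤ-⊖ m zero = sym (trans (+-congˡ -0#≈0#) (+-identityʳ _))
  fromℤ-⊖ zero (suc n) = sym (+-identityˡ _)
  fromℤ-⊖ (suc m) (suc n) = begin
    fromℤ (suc m ⊖ suc n)              ≡⟨ ≡.cong fromℤ (ℤ.[1+m]⊖[1+n]≡m⊖n m n) ⟩
    fromℤ (m ⊖ n)                      ≈⟨ fromℤ-⊖ m n ⟩
    M - N                              ≈⟨ +-congˡ (+-identityˡ _) ⟨
    M + (0# - N)                       ≈⟨ +-congˡ (+-congʳ (-‿inverseʳ 1#)) ⟨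
    M + (1# - 1# - N)                  ≈⟨ +-congˡ (+-assoc _ _ _) ⟩
    M + (1# + (- 1# - N))              ≈⟨ +-assoc _ _ _ ⟨
    M + 1# + (- 1# - N)                ≈⟨ +-cong (+-comm _ _) (⁻¹-∙-comm _ _) ⟩
    1# + M - (1# + N)                  ≈⟨ +-cong (suc-× m) (-‿cong (suc-× n)) ⟨
    suc m ×′ 1# - suc n ×′ 1#            ∎
    where
    M = m ×′ 1#
    N = n ×′ 1#

  fromℤ-neg : ∀ i → fromℤ (ℤ.- i) ≈ - fromℤ i
  fromℤ-neg (+ zero)   = sym -0#≈0#
  fromℤ-neg (+ suc n)  = refl
  fromℤ-neg (-[1+ n ]) = sym (-‿involutive _)

  fromℤ-+ : ∀ i j → fromℤ (i ℤ.+ j) ≈ fromℤ i + fromℤ j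
  fromℤ-+ (+ m) (+ n) = ×-homo-+ 1# m n
  fromℤ-+ (+ m) (-[1+ n ]) = fromℤ-⊖ m (suc n)
  fromℤ-+ (-[1+ m ]) (+ n) = trans (fromℤ-⊖ n (suc m)) (+-comm _ _)
  fromℤ-+ (-[1+ m ]) (-[1+ n ]) = begin
    - (suc (suc (m ℕ.+ n)) ×′ 1#)     ≡⟨ ≡.cong (λ k → - (suc k ×′ 1#)) (ℕ.+-suc m n) ⟨
    - ((suc m ℕ.+ suc n) ×′ 1#)       ≈⟨ -‿cong (×-homo-+ 1# (suc m) (suc n)) ⟩
    - (suc m ×′ 1# + suc n ×′ 1#)      ≈⟨ ⁻¹-∙-comm _ _ ⟨
    - (suc m ×′ 1#) - suc n ×′ 1#      ∎

  fromℤ-pos-* : ∀ m j → fromℤ (+ m ℤ.* j) ≈ m ×′ 1# * fromℤ j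
  fromℤ-pos-* m (+ n) = begin
    fromℤ (+ m ℤ.* + n)   ≡⟨ ≡.cong fromℤ (ℤ.pos-* m n) ⟨
    (m ℕ.* n) ×′ 1#        ≈⟨ ×1-homo-* m n ⟩
    m ×′ 1# * (n ×′ 1#)     ∎
  fromℤ-pos-* m (-[1+ n ]) = begin
    fromℤ (+ m ℤ.* -[1+ n ])          ≡⟨ ≡.cong fromℤ (ℤ.neg-distribʳ-* (+ m) (+ suc n)) ⟨
    fromℤ (ℤ.- (+ m ℤ.* + suc n))     ≈⟨ fromℤ-neg (+ m ℤ.* + suc n) ⟩
    - fromℤ (+ m ℤ.* + suc n)         ≈⟨ -‿cong (fromℤ-pos-* m (+ suc n)) ⟩
    - (m ×′ 1# * (suc n ×′ 1#))         ≈⟨ -‿distribʳ-* _ _ ⟩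
    m ×′ 1# * - (suc n ×′ 1#)           ∎

  fromℤ-* : ∀ i j → fromℤ (i ℤ.* j) ≈ fromℤ i * fromℤ j
  fromℤ-* (+ m) j = fromℤ-pos-* m j
  fromℤ-* (-[1+ m ]) j = begin
    fromℤ (-[1+ m ] ℤ.* j)            ≡⟨ ≡.cong fromℤ (ℤ.neg-distribˡ-* (+ suc m) j) ⟨
    fromℤ (ℤ.- (+ suc m ℤ.* j))       ≈⟨ fromℤ-neg (+ suc m ℤ.* j) ⟩
    - fromℤ (+ suc m ℤ.* j)           ≈⟨ -‿cong (fromℤ-pos-* (suc m) j) ⟩
    - (suc m ×′ 1# * fromℤ j)          ≈⟨ -‿distribˡ-* _ _ ⟩
    - (suc m ×′ 1#) * fromℤ j          ∎

  fromℤ-morphism : ℤ.+-*-rawRing -Raw-AlmostCommutative⟶ fromCommutativeRing R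
  fromℤ-morphism = record
    { ⟦_⟧    = fromℤ
    ; +-homo = fromℤ-+
    ; *-homo = fromℤ-*
    ; -‿homo = fromℤ-neg
    ; 0-homo = refl
    ; 1-homo = refl
    }

  fromℤ-≟ : WeaklyDecidable (λ i j → fromℤ i ≈ fromℤ j)
  fromℤ-≟ i j with i ℤ.≟ j
  ... | yes i≡j = just (reflexive (≡.cong fromℤ i≡j))
  ... | no _    = nothing

  open RingSolver ℤ.+-*-rawRing (fromCommutativeRing R) fromℤ-morphism fromℤ-≟ public
    using (solve; _:=_; _:+_; _:*_; _:-_; :-_; con)

-- Order and arithmetic of an ordered field.

module OrderedFieldProperties {c ℓ₁ ℓ₂} (ℝ : CompleteOrderedField c ℓ₁ ℓ₂) where
  open CompleteOrderedField ℝ public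
    using (commutativeRing; _≤_; isDecTotalOrder; 0≉1; inverse; +-monoʳ-≤; *-nonNegative;
           supremum)
  open CommutativeRing commutativeRing public hiding (zero)
  open IntegerSolver commutativeRing public
    using (solve; _:=_; _:+_; _:*_; _:-_; :-_; con)
  open RingProperties ring public using (-0#≈0#)
  open IsDecTotalOrder isDecTotalOrder public
    using (total; antisym; _≤?_; ≤-respˡ-≈; ≤-respʳ-≈)
    renaming (refl to ≤-refl; trans to ≤-trans; _≟_ to _≈?_; reflexive to ≤-reflexive)

  infix 4 _<_

  -- By totality this is the usual strict order. In negated form, a proof by contradiction applies
  -- it directly to a non-strict inequality.
  _<_ : Carrier → Carrier → Set ℓ₂
  x < y = ¬ (y ≤ x)

  ≤-resp-≈₂ : ∀ {x x′ y y′} → x ≈ x′ → y ≈ y′ → x ≤ y → x′ ≤ y′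
  ≤-resp-≈₂ p q = ≤-respˡ-≈ p ∘ ≤-respʳ-≈ q

  x≤y⇒0≤y-x : ∀ {x y} → x ≤ y → 0# ≤ y - x
  x≤y⇒0≤y-x {x} {y} x≤y =
    ≤-resp-≈₂ (-‿inverseˡ x) (+-comm (- x) y) (+-monoʳ-≤ (- x) x≤y)

  0≤y-x⇒x≤y : ∀ {x y} → 0# ≤ y - x → x ≤ y
  0≤y-x⇒x≤y {x} {y} 0≤y-x =
    ≤-resp-≈₂ (+-identityʳ x)
      (solve 2 (λ x y → x :+ (y :- x) := y) refl x y) (+-monoʳ-≤ x 0≤y-x)

  +-mono-≤ : ∀ {x y z w} → x ≤ y → z ≤ w → x + z ≤ y + w
  +-mono-≤ {x} {y} {z} {w} x≤y z≤w =
    ≤-trans (+-monoʳ-≤ x z≤w) (≤-resp-≈₂ (+-comm w x) (+-comm w y) (+-monoʳ-≤ w x≤y))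

  +-nonNegative : ∀ {x y} → 0# ≤ x → 0# ≤ y → 0# ≤ x + y
  +-nonNegative 0≤x 0≤y = ≤-respˡ-≈ (+-identityˡ 0#) (+-mono-≤ 0≤x 0≤y)

  *-monoˡ-≤ : ∀ {x y z} → 0# ≤ z → x ≤ y → z * x ≤ z * y
  *-monoˡ-≤ {x} {y} {z} 0≤z x≤y = 0≤y-x⇒x≤y $
    ≤-respʳ-≈ (solve 3 (λ x y z → z :* (y :- x) := z :* y :- z :* x) refl x y z)
      (*-nonNegative 0≤z (x≤y⇒0≤y-x x≤y))

  neg-nonNegative : ∀ {x} → x ≤ 0# → 0# ≤ - x
  neg-nonNegative x≤0 = ≤-respʳ-≈ (+-identityˡ _) (x≤y⇒0≤y-x x≤0)

  square-nonNegative : ∀ x → 0# ≤ x * x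
  square-nonNegative x with total 0# x
  ... | inj₁ 0≤x = *-nonNegative 0≤x 0≤x
  ... | inj₂ x≤0 = ≤-respʳ-≈ (solve 1 (λ x → :- x :* :- x := x :* x) refl x)
                     (*-nonNegative (neg-nonNegative x≤0) (neg-nonNegative x≤0))

  0≤1 : 0# ≤ 1#
  0≤1 = ≤-respʳ-≈ (*-identityˡ 1#) (square-nonNegative 1#)

  0<1 : 0# < 1#
  0<1 1≤0 = 0≉1 (antisym 0≤1 1≤0)

  <⇒≤ : ∀ {x y} → x < y → x ≤ y
  <⇒≤ {x} {y} x<y with total x y
  ... | inj₁ x≤y = x≤y
  ... | inj₂ y≤x = contradiction y≤x x<y

  ≤∧≉⇒< : ∀ {x y} → x ≤ y → x ≉ y → x < y
  ≤∧≉⇒< x≤y x≉y y≤x = x≉y (antisym x≤y y≤x)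

  <-≤-trans : ∀ {x y z} → x < y → y ≤ z → x < z
  <-≤-trans x<y y≤z z≤x = x<y (≤-trans y≤z z≤x)

  -- A negative `y` would make the product at most zero, hence zero, and dividing by `x` would give
  -- `y ≈ 0#`.
  *-cancelˡ-nonNegative : ∀ {x y} → 0# < x → 0# ≤ x * y → 0# ≤ y
  *-cancelˡ-nonNegative {x} {y} 0<x 0≤xy = decidable-stable (0# ≤? y) λ 0<-y →
    let -y≥0 = neg-nonNegative (<⇒≤ 0<-y)
        xy≈0 = antisym (0≤y-x⇒x≤y (≤-respʳ-≈ (solve 2 (λ x y → x :* :- y := con (+ 0) :- x :* y)
                                                  refl x y)
                 (*-nonNegative (<⇒≤ 0<x) -y≥0))) 0≤xy
        x⁻¹ , xx⁻¹≈1 = inverse x (λ x≈0 → 0<x (≤-reflexive x≈0))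
        y≈0 = begin
          y              ≈⟨ *-identityˡ y ⟨
          1# * y         ≈⟨ *-congʳ xx⁻¹≈1 ⟨
          x * x⁻¹ * y    ≈⟨ solve 3 (λ x i y → x :* i :* y := i :* (x :* y)) refl x x⁻¹ y ⟩
          x⁻¹ * (x * y)  ≈⟨ *-congˡ xy≈0 ⟩
          x⁻¹ * 0#       ≈⟨ zeroʳ x⁻¹ ⟩
          0#             ∎
    in 0<-y (≤-reflexive (sym y≈0))
    where open SetoidReasoning setoid

  *-cancelˡ-≤ : ∀ {x y z} → 0# < z → z * x ≤ z * y → x ≤ y
  *-cancelˡ-≤ {x} {y} {z} 0<z zx≤zy = 0≤y-x⇒x≤y $ *-cancelˡ-nonNegative 0<z $
    ≤-respʳ-≈ (solve 3 (λ x y z → z :* y :- z :* x := z :* (y :- x)) refl x y z) (x≤y⇒0≤y-x zx≤zy)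

  *-positive : ∀ {x y} → 0# < x → 0# < y → 0# < x * y
  *-positive {x} {y} 0<x 0<y xy≤0 = 0<y $ *-cancelˡ-≤ 0<x $ ≤-respʳ-≈ (sym (zeroʳ x)) xy≤0

  reciprocal : ∀ {x} → 0# < x → ∃ λ y → 0# < y × x * y ≈ 1#
  reciprocal {x} 0<x with inverse x (λ x≈0 → 0<x (≤-reflexive x≈0))
  ... | y , xy≈1 = y , 0<y , xy≈1
    where
    0<y : 0# < y
    0<y y≤0 = 0<1 $ ≤-respˡ-≈ xy≈1 $ ≤-respʳ-≈ (zeroʳ x) $ *-monoˡ-≤ (<⇒≤ 0<x) y≤0

  *-nonZero : ∀ {x y} → x ≉ 0# → y ≉ 0# → x * y ≉ 0#
  *-nonZero {x} {y} x≉0 y≉0 xy≈0 = y≉0 $ begin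
    y              ≈⟨ *-identityˡ y ⟨
    1# * y         ≈⟨ *-congʳ (proj₂ (inverse x x≉0)) ⟨
    x * i * y      ≈⟨ solve 3 (λ x i y → x :* i :* y := i :* (x :* y)) refl x i y ⟩
    i * (x * y)    ≈⟨ *-congˡ xy≈0 ⟩
    i * 0#         ≈⟨ zeroʳ i ⟩
    0#             ∎
    where
    open SetoidReasoning setoid
    i = proj₁ (inverse x x≉0)

  -- The factor 2 of the sharp inequality is given away to avoid halving: when x y ≥ 0 the slack is
  -- (x - y)² + x y.
  product≤squares : ∀ x y → x * y ≤ x * x + y * y
  product≤squares x y with total 0# (x * y)
  ... | inj₁ 0≤xy = 0≤y-x⇒x≤y $ ≤-respʳ-≈
          (solve 2 (λ x y → (x :- y) :* (x :- y) :+ x :* y := x :* x :+ y :* y :- x :* y) refl x y)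
          (+-nonNegative (square-nonNegative (x - y)) 0≤xy)
  ... | inj₂ xy≤0 = ≤-trans xy≤0 (+-nonNegative (square-nonNegative x) (square-nonNegative y))

  square-sum≤ : ∀ x y → (x + y) * (x + y) ≤ (x * x + x * x) + (y * y + y * y)
  square-sum≤ x y = 0≤y-x⇒x≤y $ ≤-respʳ-≈
    (solve 2 (λ x y → (x :- y) :* (x :- y)
                      := (x :* x :+ x :* x) :+ (y :* y :+ y :* y) :- (x :+ y) :* (x :+ y)) refl x y)
    (square-nonNegative (x - y))

  -- A nonzero slope would allow t = -(q + 1)/p, where the function takes the value -1.
  affine-nonNegative⇒constant : ∀ {p q} → (∀ t → 0# ≤ t * p + q) → p ≈ 0#
  affine-nonNegative⇒constant {p} {q} nonneg with p ≈? 0#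
  ... | yes p≈0 = p≈0
  ... | no  p≉0 = contradiction 1≤0 0<1
    where
    open SetoidReasoning setoid
    i = proj₁ (inverse p p≉0)
    value : - (q + 1#) * i * p + q ≈ - 1#
    value = begin
      - (q + 1#) * i * p + q
        ≈⟨ solve 4 (λ q o i p → :- (q :+ o) :* i :* p :+ q := :- (q :+ o) :* (p :* i) :+ q)
               refl q 1# i p ⟩
      - (q + 1#) * (p * i) + q  ≈⟨ +-congʳ (*-congˡ (proj₂ (inverse p p≉0))) ⟩
      - (q + 1#) * 1# + q
        ≈⟨ solve 1 (λ q → :- (q :+ con (+ 1)) :* con (+ 1) :+ q := :- con (+ 1)) refl q ⟩
      - 1#                      ∎
    1≤0 : 1# ≤ 0#
    1≤0 = 0≤y-x⇒x≤y (≤-respʳ-≈ (trans value (sym (+-identityˡ _))) (nonneg (- (q + 1#) * i)))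

-- Finite sums, the inner product and quadratic forms.

module LinearAlgebra {c ℓ₁ ℓ₂} (ℝ : CompleteOrderedField c ℓ₁ ℓ₂) where
  open OrderedFieldProperties ℝ
  open Spectrum ℝ using (Matrix; IsEigenvector; IsEigenvalue)
  open SetoidReasoning setoid
  private module S = SemiringSum semiring

  -- An opaque copy of the library's sum: the latter unfolds to a fold over the
  -- dimension, which hides the summand from unification.
  opaque
    sum : ∀ {n} → Vector Carrier n → Carrier
    sum = S.sum

    sum≡S-sum : ∀ {n} (f : Vector Carrier n) → sum f ≡ S.sum f
    sum≡S-sum f = ≡.refl

    sum-cong : ∀ {n} {f g : Vector Carrier n} → (∀ a → f a ≈ g a) → sum f ≈ sum g
    sum-cong = S.sum-cong-≋

    sum-suc : ∀ {n} (f : Vector Carrier (suc n)) → sum f ≈ f zero + sum (λ a → f (suc a))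
    sum-suc f = refl

    sum-remove : ∀ {n} p (f : Vector Carrier (suc n)) → sum f ≈ f p + sum (λ a → f (punchIn p a))
    sum-remove p f = S.sum-remove {i = p} f

    sum-comm : ∀ {m n} (f : Fin m → Fin n → Carrier) →
               sum (λ a → sum (λ b → f a b)) ≈ sum (λ b → sum (λ a → f a b))
    sum-comm = S.∑-comm

    sum-distrib-+ : ∀ {n} (f g : Vector Carrier n) → sum (λ a → f a + g a) ≈ sum f + sum g
    sum-distrib-+ = S.∑-distrib-+

    *-distribˡ-sum : ∀ {n} α (f : Vector Carrier n) → α * sum f ≈ sum (λ a → α * f a)
    *-distribˡ-sum = S.*-distribˡ-sum

    sum-zero : ∀ {n} (f : Vector Carrier n) → (∀ a → f a ≈ 0#) → sum f ≈ 0#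
    sum-zero {n} f f≈0 = trans (S.sum-cong-≋ f≈0) (S.sum-replicate-zero n)

    sum-mono-≤ : ∀ {n} {f g : Vector Carrier n} → (∀ a → f a ≤ g a) → sum f ≤ sum g
    sum-mono-≤ {zero}  f≤g = ≤-refl
    sum-mono-≤ {suc n} f≤g = +-mono-≤ (f≤g zero) (sum-mono-≤ (λ a → f≤g (suc a)))

  sum-linear : ∀ {n} α β (f g : Vector Carrier n) →
               sum (λ a → α * f a + β * g a) ≈ α * sum f + β * sum g
  sum-linear α β f g = trans (sum-distrib-+ _ _)
    (+-cong (sym (*-distribˡ-sum α f)) (sym (*-distribˡ-sum β g)))

  sum-nonNegative : ∀ {n} (f : Vector Carrier n) → (∀ a → 0# ≤ f a) → 0# ≤ sum f
  sum-nonNegative {n} f 0≤f = ≤-respˡ-≈ (sum-zero {n} _ (λ a → refl)) (sum-mono-≤ 0≤f)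

  sum-single : ∀ {n} (f : Vector Carrier n) p → (∀ a → a ≢ p → f a ≈ 0#) → sum f ≈ f p
  sum-single {suc n} f p off = begin
    sum f                     ≈⟨ sum-remove p f ⟩
    f p + sum (λ a → f (punchIn p a)) ≈⟨ +-congˡ (sum-zero _ (λ a → off _ (punchInᵢ≢i p a))) ⟩
    f p + 0#                  ≈⟨ +-identityʳ _ ⟩
    f p                       ∎

  sum-pair : ∀ {n} (f : Vector Carrier n) {p q} → p ≢ q →
             (∀ a → a ≢ p → a ≢ q → f a ≈ 0#) → sum f ≈ f p + f q
  sum-pair {suc n} f {p} {q} p≢q off = begin
    sum f                               ≈⟨ sum-remove p f ⟩
    f p + sum (λ a → f (punchIn p a))           ≈⟨ +-congˡ (sum-single _ (punchOut p≢q) off′) ⟩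
    f p + f (punchIn p (punchOut p≢q))  ≡⟨ ≡.cong (λ a → f p + f a) (punchIn-punchOut p≢q) ⟩
    f p + f q                           ∎
    where
    off′ : ∀ a → a ≢ punchOut p≢q → f (punchIn p a) ≈ 0#
    off′ a a≢ = off _ (punchInᵢ≢i p a) λ eq → a≢ $
      ≡.trans (≡.sym (punchOut-punchIn p)) (punchOut-cong p eq)

  infixr 7 _·_
  _·_ : ∀ {n} → Matrix n → Vector Carrier n → Vector Carrier n
  (M · x) a = sum (λ b → M a b * x b)

  ⟪_,_⟫ : ∀ {n} → Vector Carrier n → Vector Carrier n → Carrier
  ⟪ x , y ⟫ = sum (λ a → x a * y a)

  form : ∀ {n} → Matrix n → Vector Carrier n → Carrier
  form M x = ⟪ x , M · x ⟫

  NonZero : ∀ {n} → Vector Carrier n → Set ℓ₁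
  NonZero x = ∃ λ a → x a ≉ 0#

  Symmetric : ∀ {n} → Matrix n → Set ℓ₁
  Symmetric M = ∀ a b → M a b ≈ M b a

  PositiveSemidefinite : ∀ {n} → Matrix n → Set _
  PositiveSemidefinite M = ∀ z → 0# ≤ form M z

  infixl 6 _∙_⊕_∙_
  _∙_⊕_∙_ : ∀ {n} → Carrier → Vector Carrier n → Carrier → Vector Carrier n → Vector Carrier n
  (α ∙ x ⊕ β ∙ y) a = α * x a + β * y a

  nonZero? : ∀ {n} (x : Vector Carrier n) → NonZero x ⊎ (∀ a → x a ≈ 0#)
  nonZero? x with all? (λ a → x a ≈? 0#)
  ... | yes x≈0 = inj₂ x≈0
  ... | no  x≉0 = inj₁ (¬∀⟶∃¬ _ _ (λ a → x a ≈? 0#) x≉0)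

  ⟪x,x⟫-nonNegative : ∀ {n} (x : Vector Carrier n) → 0# ≤ ⟪ x , x ⟫
  ⟪x,x⟫-nonNegative x = sum-nonNegative _ (λ a → square-nonNegative (x a))

  ⟪x,x⟫-positive : ∀ {n} {x : Vector Carrier n} → NonZero x → 0# < ⟪ x , x ⟫
  ⟪x,x⟫-positive {suc n} {x} (a , xa≉0) = <-≤-trans
    (≤∧≉⇒< (square-nonNegative (x a)) (λ 0≈ → *-nonZero xa≉0 xa≉0 (sym 0≈)))
    (≤-resp-≈₂ (+-identityʳ _) (sym (sum-remove a _))
      (+-monoʳ-≤ _ (sum-nonNegative _ (λ b → square-nonNegative (x (punchIn a b))))))

  ⟪x,x⟫≈0⇒x≈0 : ∀ {n} (x : Vector Carrier n) → ⟪ x , x ⟫ ≈ 0# → ∀ a → x a ≈ 0#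
  ⟪x,x⟫≈0⇒x≈0 x ⟪x,x⟫≈0 a with x a ≈? 0#
  ... | yes xa≈0 = xa≈0
  ... | no  xa≉0 = contradiction (≤-reflexive ⟪x,x⟫≈0) (⟪x,x⟫-positive (a , xa≉0))

  ⟪⟫-comm : ∀ {n} (x y : Vector Carrier n) → ⟪ x , y ⟫ ≈ ⟪ y , x ⟫
  ⟪⟫-comm x y = sum-cong (λ a → *-comm (x a) (y a))

  ⟪⟫-congʳ : ∀ {n} (x : Vector Carrier n) {y z} → (∀ a → y a ≈ z a) → ⟪ x , y ⟫ ≈ ⟪ x , z ⟫
  ⟪⟫-congʳ x y≈z = sum-cong (λ a → *-congˡ (y≈z a))

  ⟪⟫-linearʳ : ∀ {n} (w : Vector Carrier n) α x β y →
               ⟪ w , α ∙ x ⊕ β ∙ y ⟫ ≈ α * ⟪ w , x ⟫ + β * ⟪ w , y ⟫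
  ⟪⟫-linearʳ w α x β y = trans
    (sum-cong λ a → solve 5 (λ w α x β y → w :* (α :* x :+ β :* y) := α :* (w :* x) :+ β :* (w :* y))
                        refl (w a) α (x a) β (y a))
    (sum-linear α β _ _)

  ⟪⟫-scaleʳ : ∀ {n} (x : Vector Carrier n) α y → ⟪ x , (λ a → α * y a) ⟫ ≈ α * ⟪ x , y ⟫
  ⟪⟫-scaleʳ x α y = trans
    (sum-cong λ a → solve 3 (λ x α y → x :* (α :* y) := α :* (x :* y)) refl (x a) α (y a))
    (sym (*-distribˡ-sum α _))

  form-scale : ∀ {n} (M : Matrix n) α x → form M (λ a → α * x a) ≈ α * α * form M x
  form-scale M α x = begin
    ⟪ αx , M · αx ⟫                    ≈⟨ ⟪⟫-congʳ αx (λ a → ⟪⟫-scaleʳ (M a) α x) ⟩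
    ⟪ αx , (λ a → α * (M · x) a) ⟫     ≈⟨ ⟪⟫-scaleʳ αx α (M · x) ⟩
    α * ⟪ αx , M · x ⟫                 ≈⟨ *-congˡ (trans (⟪⟫-comm αx _) (⟪⟫-scaleʳ (M · x) α x)) ⟩
    α * (α * ⟪ M · x , x ⟫)            ≈⟨ *-congˡ (*-congˡ (⟪⟫-comm _ x)) ⟩
    α * (α * form M x)                 ≈⟨ *-assoc α α _ ⟨
    α * α * form M x                   ∎
    where
    αx = λ a → α * x a

  ·-self-adjoint : ∀ {n} {M : Matrix n} → Symmetric M → ∀ x y → ⟪ x , M · y ⟫ ≈ ⟪ y , M · x ⟫
  ·-self-adjoint {M = M} M-sym x y = begin
    sum (λ a → x a * sum (λ b → M a b * y b))   ≈⟨ sum-cong (λ a → *-distribˡ-sum (x a) _) ⟩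
    sum (λ a → sum (λ b → x a * (M a b * y b))) ≈⟨ sum-comm _ ⟩
    sum (λ b → sum (λ a → x a * (M a b * y b))) ≈⟨ sum-cong (λ b → sum-cong (λ a → swap a b)) ⟩
    sum (λ b → sum (λ a → y b * (M b a * x a))) ≈⟨ sum-cong (λ b → *-distribˡ-sum (y b) _) ⟨
    sum (λ b → y b * sum (λ a → M b a * x a))   ∎
    where
    swap : ∀ a b → x a * (M a b * y b) ≈ y b * (M b a * x a)
    swap a b = trans (*-congˡ (*-congʳ (M-sym a b)))
      (solve 3 (λ x m y → x :* (m :* y) := y :* (m :* x)) refl (x a) (M b a) (y b))

  form-combination : ∀ {n} {M : Matrix n} → Symmetric M → ∀ α x β y →
    form M (α ∙ x ⊕ β ∙ y) ≈
    α * α * form M x + (α * β + α * β) * ⟪ y , M · x ⟫ + β * β * form M y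
  form-combination {M = M} M-sym α x β y = begin
    ⟪ z , M · z ⟫                                  ≈⟨ ⟪⟫-congʳ z (λ a → ⟪⟫-linearʳ (M a) α x β y) ⟩
    ⟪ z , α ∙ M · x ⊕ β ∙ M · y ⟫                  ≈⟨ ⟪⟫-linearʳ z α (M · x) β (M · y) ⟩
    α * ⟪ z , M · x ⟫ + β * ⟪ z , M · y ⟫
      ≈⟨ +-cong (*-congˡ (left (M · x))) (*-congˡ (left (M · y))) ⟩
    α * (α * form M x + β * ⟪ y , M · x ⟫) + β * (α * ⟪ x , M · y ⟫ + β * form M y)
      ≈⟨ +-congˡ (*-congˡ (+-congʳ (*-congˡ (·-self-adjoint M-sym x y)))) ⟩
    α * (α * form M x + β * ⟪ y , M · x ⟫) + β * (α * ⟪ y , M · x ⟫ + β * form M y)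
      ≈⟨ solve 5 (λ α β p q r → α :* (α :* p :+ β :* q) :+ β :* (α :* q :+ β :* r)
                   := α :* α :* p :+ (α :* β :+ α :* β) :* q :+ β :* β :* r)
           refl α β (form M x) ⟪ y , M · x ⟫ (form M y) ⟩
    α * α * form M x + (α * β + α * β) * ⟪ y , M · x ⟫ + β * β * form M y ∎
    where
    z = α ∙ x ⊕ β ∙ y
    left : ∀ w → ⟪ z , w ⟫ ≈ α * ⟪ x , w ⟫ + β * ⟪ y , w ⟫
    left w = trans (⟪⟫-comm z w) (trans (⟪⟫-linearʳ w α x β y)
      (+-cong (*-congˡ (⟪⟫-comm w x)) (*-congˡ (⟪⟫-comm w y))))

-- Semidefinite symmetric matrices: singular or definite.

module Rayleigh {c ℓ₁ ℓ₂} (ℝ : CompleteOrderedField c ℓ₁ ℓ₂) where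
  open OrderedFieldProperties ℝ
  open LinearAlgebra ℝ
  open Spectrum ℝ using (Matrix; IsEigenvector; IsEigenvalue)
  open SetoidReasoning setoid

  -- A weak Cauchy-Schwarz inequality. Some constant suffices, so each coordinate is split off by (a
  -- + b)² ≤ 2a² + 2b² and the constant is doubled on the way, instead of reaching ⟪r, r⟫.
  ⟪⟫²-bounded : ∀ {n} (r : Vector Carrier n) →
                ∃ λ R → 0# ≤ R × ∀ y → ⟪ r , y ⟫ * ⟪ r , y ⟫ ≤ R * ⟪ y , y ⟫
  ⟪⟫²-bounded {zero} r = 0# , ≤-refl , λ y → ≤-reflexive $ trans
    (*-congʳ (sum-zero _ (λ ()))) (trans (zeroˡ _) (sym (zeroˡ _)))
  ⟪⟫²-bounded {suc n} r with ⟪⟫²-bounded (tail r)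
  ... | R , 0≤R , bound = (s + s) + (R + R) , +-nonNegative 0≤2s 0≤2R , λ y →
    let t = y zero
        ρ = ⟪ tail r , tail y ⟫
        Y = ⟪ tail y , tail y ⟫
        e = sum-suc (λ a → r a * y a)
    in ≤-resp-≈₂ (sym (*-cong e e)) (*-congˡ (sym (sum-suc (λ a → y a * y a)))) $
       ≤-trans (square-sum≤ (r zero * t) ρ) $
       0≤y-x⇒x≤y $ ≤-respʳ-≈
         (solve 5 (λ r t ρ R Y →
             (r :* r :+ r :* r) :* Y :+ (R :+ R) :* (t :* t) :+ ((R :* Y :- ρ :* ρ) :+ (R :* Y :- ρ :* ρ))
             := ((r :* r :+ r :* r) :+ (R :+ R)) :* (t :* t :+ Y)
                :- ((r :* t :* (r :* t) :+ r :* t :* (r :* t)) :+ (ρ :* ρ :+ ρ :* ρ)))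
           refl (r zero) t ρ R Y)
         (+-nonNegative
           (+-nonNegative (*-nonNegative 0≤2s (⟪x,x⟫-nonNegative (tail y)))
                          (*-nonNegative 0≤2R (square-nonNegative t)))
           (+-nonNegative (x≤y⇒0≤y-x (bound (tail y))) (x≤y⇒0≤y-x (bound (tail y)))))
    where
    s = r zero * r zero
    0≤2s = +-nonNegative (square-nonNegative (r zero)) (square-nonNegative (r zero))
    0≤2R = +-nonNegative 0≤R 0≤R

  -- Each summand z a · (M z) a is at most (z a)² + ((M z) a)², and the second square is controlled
  -- by the bound for row `a`. This makes the set of Rayleigh quotients bounded above.
  form-bounded : ∀ {n} (M : Matrix n) → ∃ λ K → ∀ z → form M z ≤ K * ⟪ z , z ⟫
  form-bounded M = 1# + sum R , λ z →
    ≤-respʳ-≈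
      (begin
        sum (λ a → z a * z a + R a * ⟪ z , z ⟫)              ≈⟨ sum-distrib-+ _ _ ⟩
        ⟪ z , z ⟫ + sum (λ a → R a * ⟪ z , z ⟫)
          ≈⟨ +-congˡ (sum-cong (λ a → *-comm (R a) _)) ⟩
        ⟪ z , z ⟫ + sum (λ a → ⟪ z , z ⟫ * R a)              ≈⟨ +-congˡ (*-distribˡ-sum _ R) ⟨
        ⟪ z , z ⟫ + ⟪ z , z ⟫ * sum R
          ≈⟨ solve 2 (λ q r → q :+ q :* r := (con (+ 1) :+ r) :* q) refl ⟪ z , z ⟫ (sum R) ⟩
        (1# + sum R) * ⟪ z , z ⟫                             ∎)
      (sum-mono-≤ λ a → ≤-trans (product≤squares (z a) ((M · z) a))
                                (+-monoʳ-≤ _ (proj₂ (proj₂ (⟪⟫²-bounded (M a))) z)))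
    where
    R = λ a → proj₁ (⟪⟫²-bounded (M a))

  corner : ∀ {n} → Matrix (suc n) → Matrix n
  corner M a b = M (suc a) (suc b)

  form-corner : ∀ {n} {M : Matrix (suc n)} → Symmetric M → ∀ t y →
    form M (t ∷ y) ≈
    M zero zero * (t * t) + (t * ⟪ tail (M zero) , y ⟫ + t * ⟪ tail (M zero) , y ⟫) + form (corner M) y
  form-corner {M = M} M-sym t y = begin
    form M z                                        ≈⟨ sum-suc _ ⟩
    t * (M · z) zero + sum (λ a → y a * (M · z) (suc a))
      ≈⟨ +-cong (*-congˡ (sum-suc _)) (sum-cong λ a → *-congˡ (trans (sum-suc _) (+-congʳ (*-congʳ (M-sym (suc a) zero))))) ⟩
    t * (b * t + ρ) + sum (λ a → y a * (r a * t + (C · y) a))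
      ≈⟨ +-congˡ (sum-cong λ a → solve 4 (λ y r t c → y :* (r :* t :+ c) := t :* (r :* y) :+ y :* c)
                                     refl (y a) (r a) t ((C · y) a)) ⟩
    t * (b * t + ρ) + sum (λ a → t * (r a * y a) + y a * (C · y) a)
      ≈⟨ +-congˡ (trans (sum-distrib-+ _ _) (+-congʳ (sym (*-distribˡ-sum t _)))) ⟩
    t * (b * t + ρ) + (t * ρ + form C y)
      ≈⟨ solve 4 (λ b t ρ q → t :* (b :* t :+ ρ) :+ (t :* ρ :+ q) := b :* (t :* t) :+ (t :* ρ :+ t :* ρ) :+ q)
             refl b t ρ (form C y) ⟩
    b * (t * t) + (t * ρ + t * ρ) + form C y        ∎
    where
    z = t ∷ y
    b = M zero zero
    r = tail (M zero)
    C = corner M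
    ρ = ⟪ r , y ⟫

  -- The Schur complement of the top left entry, multiplied by that entry.
  schur : ∀ {n} → Matrix (suc n) → Matrix n
  schur M a b = M zero zero * M (suc a) (suc b) - M zero (suc a) * M zero (suc b)

  schur-symmetric : ∀ {n} {M : Matrix (suc n)} → Symmetric M → Symmetric (schur M)
  schur-symmetric M-sym a b = +-cong (*-congˡ (M-sym (suc a) (suc b))) (-‿cong (*-comm _ _))

  schur-· : ∀ {n} (M : Matrix (suc n)) y a →
    (schur M · y) a ≈ M zero zero * (corner M · y) a - M zero (suc a) * ⟪ tail (M zero) , y ⟫
  schur-· M y a = begin
    (schur M · y) a
      ≈⟨ sum-cong (λ b → solve 5 (λ m c p q y → (m :* c :- p :* q) :* y := m :* (c :* y) :+ (:- p) :* (q :* y))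
           refl (M zero zero) (M (suc a) (suc b)) (M zero (suc a)) (M zero (suc b)) (y b)) ⟩
    sum (λ b → M zero zero * (corner M a b * y b) + - M zero (suc a) * (M zero (suc b) * y b))
      ≈⟨ sum-linear _ _ _ _ ⟩
    M zero zero * (corner M · y) a + - M zero (suc a) * ⟪ tail (M zero) , y ⟫
      ≈⟨ solve 3 (λ p q s → s :+ (:- p) :* q := s :- p :* q)
             refl (M zero (suc a)) ⟪ tail (M zero) , y ⟫ _ ⟩
    M zero zero * (corner M · y) a - M zero (suc a) * ⟪ tail (M zero) , y ⟫ ∎

  form-schur : ∀ {n} (M : Matrix (suc n)) y →
    form (schur M) y ≈ M zero zero * form (corner M) y - ⟪ tail (M zero) , y ⟫ * ⟪ tail (M zero) , y ⟫
  form-schur M y = begin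
    form (schur M) y
      ≈⟨ ⟪⟫-congʳ y (λ a → trans (schur-· M y a)
           (solve 4 (λ b c r ρ → b :* c :- r :* ρ := b :* c :+ (:- ρ) :* r)
                refl b ((corner M · y) a) (r a) ρ)) ⟩
    ⟪ y , b ∙ corner M · y ⊕ - ρ ∙ r ⟫          ≈⟨ ⟪⟫-linearʳ y b _ (- ρ) r ⟩
    b * form (corner M) y + - ρ * ⟪ y , r ⟫     ≈⟨ +-congˡ (*-congˡ (⟪⟫-comm y r)) ⟩
    b * form (corner M) y + - ρ * ρ
      ≈⟨ solve 2 (λ s ρ → s :+ (:- ρ) :* ρ := s :- ρ :* ρ) refl _ ρ ⟩
    b * form (corner M) y - ρ * ρ               ∎
    where
    b = M zero zero
    r = tail (M zero)
    ρ = ⟪ r , y ⟫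

  -- Completing the square in the first coordinate, multiplied by the corner entry so that nothing
  -- is divided. For a positive corner it carries semidefiniteness down to `schur M` and
  -- definiteness back up.
  complete-square : ∀ {n} {M : Matrix (suc n)} → Symmetric M → ∀ t y →
    let u = M zero zero * t + ⟪ tail (M zero) , y ⟫ in
    M zero zero * form M (t ∷ y) ≈ u * u + form (schur M) y
  complete-square {M = M} M-sym t y = begin
    b * form M (t ∷ y)                                          ≈⟨ *-congˡ (form-corner M-sym t y) ⟩
    b * (b * (t * t) + (t * ρ + t * ρ) + form (corner M) y)
      ≈⟨ solve 4 (λ b t ρ q → b :* (b :* (t :* t) :+ (t :* ρ :+ t :* ρ) :+ q)
                   := (b :* t :+ ρ) :* (b :* t :+ ρ) :+ (b :* q :- ρ :* ρ)) refl b t ρ (form (corner M) y) ⟩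
    (b * t + ρ) * (b * t + ρ) + (b * form (corner M) y - ρ * ρ) ≈⟨ +-congˡ (form-schur M y) ⟨
    (b * t + ρ) * (b * t + ρ) + form (schur M) y                ∎
    where
    b = M zero zero
    ρ = ⟪ tail (M zero) , y ⟫

  -- `z` and `head z ∷ tail z` agree only pointwise, not as functions, so the form has to be
  -- transported by hand.
  form-head-tail : ∀ {n} (M : Matrix (suc n)) z → form M z ≈ form M (head z ∷ tail z)
  form-head-tail M z = trans (sum-suc _) (trans (+-cong (*-congˡ (row zero)) (sum-cong λ a → *-congˡ (row (suc a)))) (sym (sum-suc _)))
    where
    row : ∀ a → (M · z) a ≈ (M · (head z ∷ tail z)) a
    row a = trans (sum-suc _) (sym (sum-suc _))

  Singular : ∀ {n} → Matrix n → Set _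
  Singular M = ∃ λ x → NonZero x × ∀ a → (M · x) a ≈ 0#

  -- A uniform δ rather than mere positivity at nonzero vectors: a uniform gap is what can be
  -- subtracted from a supremum.
  Definite : ∀ {n} → Matrix n → Set _
  Definite M = ∃ λ δ → 0# < δ × ∀ z → δ * ⟪ z , z ⟫ ≤ form M z

  corner-positive : ∀ {n} {M : Matrix (suc n)} → PositiveSemidefinite M → 0# ≤ M zero zero
  corner-positive {n} {M} psd = ≤-respʳ-≈ value (psd e₀)
    where
    e₀ : Vector Carrier (suc n)
    e₀ = 1# ∷ λ _ → 0#
    value : form M e₀ ≈ M zero zero
    value = begin
      form M e₀                                ≈⟨ sum-suc _ ⟩
      1# * (M · e₀) zero + sum (λ a → 0# * (M · e₀) (suc a))
        ≈⟨ +-cong (trans (*-identityˡ _) (sum-suc _)) (sum-zero _ λ a → zeroˡ _) ⟩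
      M zero zero * 1# + sum (λ b → M zero (suc b) * 0#) + 0#
        ≈⟨ +-congʳ (+-congˡ (sum-zero _ λ b → zeroʳ _)) ⟩
      M zero zero * 1# + 0# + 0#
        ≈⟨ solve 1 (λ m → m :* con (+ 1) :+ con (+ 0) :+ con (+ 0) := m) refl _ ⟩
      M zero zero                              ∎

  -- With a zero corner, the form at (t, r), for r the rest of the first row, is affine in t with
  -- slope 2⟪r, r⟫. Being nonnegative for all t it has slope zero, so r = 0 and the first basis
  -- vector lies in the kernel.
  zero-corner⇒singular : ∀ {n} {M : Matrix (suc n)} → Symmetric M → PositiveSemidefinite M →
                         M zero zero ≈ 0# → Singular M
  zero-corner⇒singular {n} {M} M-sym psd b≈0 = e₀ , (zero , 0≉1 ∘ sym) , λ where
      zero    → trans (column zero) b≈0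
      (suc a) → trans (column (suc a)) (trans (M-sym (suc a) zero) (r≈0 a))
    where
    e₀ : Vector Carrier (suc n)
    e₀ = 1# ∷ λ _ → 0#
    column : ∀ a → (M · e₀) a ≈ M a zero
    column a = trans (sum-suc _) (trans (+-cong (*-identityʳ _) (sum-zero _ λ b → zeroʳ _)) (+-identityʳ _))
    r = tail (M zero)
    r≈0 : ∀ a → r a ≈ 0#
    r≈0 = ⟪x,x⟫≈0⇒x≈0 r $ ≈half $ affine-nonNegative⇒constant λ t → ≤-respʳ-≈
      (begin
        form M (t ∷ r)                                                       ≈⟨ form-corner M-sym t r ⟩
        M zero zero * (t * t) + (t * ⟪ r , r ⟫ + t * ⟪ r , r ⟫) + form (corner M) r
          ≈⟨ +-congʳ (+-congʳ (*-congʳ b≈0)) ⟩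
        0# * (t * t) + (t * ⟪ r , r ⟫ + t * ⟪ r , r ⟫) + form (corner M) r
          ≈⟨ solve 3 (λ t q f → con (+ 0) :* (t :* t) :+ (t :* q :+ t :* q) :+ f := t :* (q :+ q) :+ f)
                 refl t ⟪ r , r ⟫ (form (corner M) r) ⟩
        t * (⟪ r , r ⟫ + ⟪ r , r ⟫) + form (corner M) r                      ∎)
      (psd (t ∷ r))
      where
      ≈half : ⟪ r , r ⟫ + ⟪ r , r ⟫ ≈ 0# → ⟪ r , r ⟫ ≈ 0#
      ≈half 2q≈0 = antisym
        (≤-resp-≈₂ (+-identityʳ _) 2q≈0 (+-monoʳ-≤ _ (⟪x,x⟫-nonNegative r))) (⟪x,x⟫-nonNegative r)

  -- The vector (-ρ, b y) makes the completed square vanish; it is the minimiser -ρ/b over (·, y),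
  -- scaled by `b`. The form of `schur M` then appears with a factor b², removed by cancelling `b`
  -- twice.
  schur-psd : ∀ {n} {M : Matrix (suc n)} → Symmetric M → PositiveSemidefinite M → 0# < M zero zero →
              PositiveSemidefinite (schur M)
  schur-psd {M = M} M-sym psd 0<b y = *-cancelˡ-nonNegative 0<b $ *-cancelˡ-nonNegative 0<b $ ≤-respʳ-≈
    (begin
      b * form M (- ρ ∷ λ a → b * y a)     ≈⟨ complete-square M-sym _ _ ⟩
      (b * - ρ + ⟪ r , (λ a → b * y a) ⟫) * (b * - ρ + ⟪ r , (λ a → b * y a) ⟫) + form (schur M) (λ a → b * y a)
        ≈⟨ +-cong (*-cong eq eq) (form-scale (schur M) b y) ⟩
      (b * - ρ + b * ρ) * (b * - ρ + b * ρ) + b * b * form (schur M) y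
        ≈⟨ solve 3 (λ b ρ s → (b :* :- ρ :+ b :* ρ) :* (b :* :- ρ :+ b :* ρ) :+ b :* b :* s := b :* (b :* s))
               refl b ρ _ ⟩
      b * (b * form (schur M) y)           ∎)
    (*-nonNegative (<⇒≤ 0<b) (psd _))
    where
    b = M zero zero
    r = tail (M zero)
    ρ = ⟪ r , y ⟫
    eq : b * - ρ + ⟪ r , (λ a → b * y a) ⟫ ≈ b * - ρ + b * ρ
    eq = +-congˡ (⟪⟫-scaleʳ r b y)

  -- The same vector (-ρ, b y) lifts a kernel vector: the choice of -ρ cancels the first row, and
  -- every other row reproduces that of `schur M`.
  schur-singular : ∀ {n} {M : Matrix (suc n)} → Symmetric M → 0# < M zero zero →
                   Singular (schur M) → Singular M
  schur-singular {M = M} M-sym 0<b (y , (a₀ , ya₀≉0) , Sy≈0) =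
    x , (suc a₀ , *-nonZero (λ b≈0 → 0<b (≤-reflexive b≈0)) ya₀≉0) , λ where
      zero → begin
        (M · x) zero                          ≈⟨ sum-suc _ ⟩
        b * - ρ + ⟪ r , (λ a → b * y a) ⟫     ≈⟨ +-congˡ (⟪⟫-scaleʳ r b y) ⟩
        b * - ρ + b * ρ
          ≈⟨ solve 2 (λ b ρ → b :* :- ρ :+ b :* ρ := con (+ 0)) refl b ρ ⟩
        0#                                    ∎
      (suc a) → begin
        (M · x) (suc a)                                    ≈⟨ sum-suc _ ⟩
        M (suc a) zero * - ρ + ⟪ corner M a , (λ b′ → b * y b′) ⟫
          ≈⟨ +-cong (*-congʳ (M-sym (suc a) zero)) (⟪⟫-scaleʳ (corner M a) b y) ⟩
        r a * - ρ + b * (corner M · y) a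
          ≈⟨ solve 3 (λ r ρ s → r :* :- ρ :+ s := s :- r :* ρ) refl (r a) ρ _ ⟩
        b * (corner M · y) a - r a * ρ                     ≈⟨ schur-· M y a ⟨
        (schur M · y) a                                    ≈⟨ Sy≈0 a ⟩
        0#                                                 ∎
    where
    b = M zero zero
    r = tail (M zero)
    ρ = ⟪ r , y ⟫
    x = - ρ ∷ λ a → b * y a


  -- The scalar core of the next lemma, with P the completed square, s the form of the Schur
  -- complement, B = b² and X = b²t². The bound on X gives δX + δBY ≤ 2δP + (2R + B)δY; then δY ≤ s
  -- replaces δY, and the coefficients of P and s are both raised to their sum.
  definite-estimate : ∀ {δ R B X Y P s} → 0# ≤ δ → 0# ≤ R → 0# ≤ B → 0# ≤ P → 0# ≤ s →
    δ * Y ≤ s → X ≤ (P + P) + (R * Y + R * Y) →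
    δ * X + δ * (B * Y) ≤ ((δ + δ) + ((R + R) + B)) * (P + s)
  definite-estimate {δ} {R} {B} {X} {Y} {P} {s} 0≤δ 0≤R 0≤B 0≤P 0≤s δY≤s X≤ = ≤-trans
    (0≤y-x⇒x≤y $ ≤-respʳ-≈
      (solve 6 (λ δ X B Y P R →
           δ :* ((P :+ P) :+ (R :* Y :+ R :* Y) :- X)
           := (δ :+ δ) :* P :+ ((R :+ R) :+ B) :* (δ :* Y) :- (δ :* X :+ δ :* (B :* Y)))
         refl δ X B Y P R)
      (*-nonNegative 0≤δ (x≤y⇒0≤y-x X≤)))
    (0≤y-x⇒x≤y $ ≤-respʳ-≈
      (solve 5 (λ δ k P s Y →
           k :* P :+ (δ :+ δ) :* s :+ k :* (s :- δ :* Y)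
           := ((δ :+ δ) :+ k) :* (P :+ s) :- ((δ :+ δ) :* P :+ k :* (δ :* Y)))
         refl δ k P s Y)
      (+-nonNegative
        (+-nonNegative (*-nonNegative 0≤k 0≤P) (*-nonNegative (+-nonNegative 0≤δ 0≤δ) 0≤s))
        (*-nonNegative 0≤k (x≤y⇒0≤y-x δY≤s))))
    where
    k = (R + R) + B
    0≤k = +-nonNegative (+-nonNegative 0≤R 0≤R) 0≤B

  schur-estimate : ∀ {n} {M : Matrix (suc n)} → Symmetric M → ∀ {δ R} → 0# ≤ δ → 0# ≤ R →
    let b = M zero zero ; r = tail (M zero) in
    (∀ y → ⟪ r , y ⟫ * ⟪ r , y ⟫ ≤ R * ⟪ y , y ⟫) → (∀ y → δ * ⟪ y , y ⟫ ≤ form (schur M) y) →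
    ∀ t y → δ * (b * b * (t * t)) + δ * (b * b * ⟪ y , y ⟫) ≤
            ((δ + δ) + ((R + R) + b * b)) * (b * form M (t ∷ y))
  schur-estimate {M = M} M-sym {δ} {R} 0≤δ 0≤R r≤R S≥δ t y =
    ≤-respʳ-≈ (*-congˡ (sym (complete-square M-sym t y)))
      (definite-estimate 0≤δ 0≤R (square-nonNegative b) (square-nonNegative u)
        (≤-trans (*-nonNegative 0≤δ (⟪x,x⟫-nonNegative y)) (S≥δ y)) (S≥δ y) b²t²≤)
    where
    b = M zero zero
    ρ = ⟪ tail (M zero) , y ⟫
    u = b * t + ρ
    b²t²≤ : b * b * (t * t) ≤ (u * u + u * u) + (R * ⟪ y , y ⟫ + R * ⟪ y , y ⟫)
    -- Since b t = u - ρ, its square is at most 2u² + 2ρ².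
    b²t²≤ = ≤-trans
      (≤-resp-≈₂
        (solve 3 (λ b t ρ → (b :* t :+ ρ :+ :- ρ) :* (b :* t :+ ρ :+ :- ρ) := b :* b :* (t :* t))
             refl b t ρ)
        (+-congˡ (solve 1 (λ ρ → (:- ρ) :* (:- ρ) :+ (:- ρ) :* (:- ρ) := ρ :* ρ :+ ρ :* ρ) refl ρ))
        (square-sum≤ u (- ρ)))
      (+-monoʳ-≤ _ (+-mono-≤ (r≤R y) (r≤R y)))

  definite-scale : ∀ {n} {M : Matrix n} {κ δ} → 0# < κ → 0# < δ →
    (∀ z → δ * ⟪ z , z ⟫ ≤ κ * form M z) → Definite M
  definite-scale {M = M} {κ} {δ} 0<κ 0<δ bound with reciprocal 0<κ
  ... | i , 0<i , κi≈1 = i * δ , *-positive 0<i 0<δ , λ z →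
    ≤-resp-≈₂ (sym (*-assoc i _ _))
      (trans (solve 3 (λ i k q → i :* (k :* q) := k :* i :* q) refl i κ (form M z))
        (trans (*-congʳ κi≈1) (*-identityˡ _)))
      (*-monoˡ-≤ (<⇒≤ 0<i) (bound z))

  -- The constant obtained is δb²/(Kb) with K = 2δ + 2R + b²; the summand b² alone already makes K
  -- positive.
  schur-definite : ∀ {n} {M : Matrix (suc n)} → Symmetric M → 0# < M zero zero →
                   Definite (schur M) → Definite M
  schur-definite {M = M} M-sym 0<b (δ , 0<δ , S≥δ) with ⟪⟫²-bounded (tail (M zero))
  ... | R , 0≤R , r≤R = definite-scale (*-positive 0<K 0<b) (*-positive 0<δ 0<b²) λ z →
    ≤-resp-≈₂
      (trans (solve 4 (λ δ B T Y → δ :* (B :* T) :+ δ :* (B :* Y) := δ :* B :* (T :+ Y))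
                  refl δ (b * b) _ _)
        (*-congˡ (sym (sum-suc _))))
      (trans (*-congˡ (*-congˡ (sym (form-head-tail M z)))) (sym (*-assoc _ b _)))
      (schur-estimate M-sym (<⇒≤ 0<δ) 0≤R r≤R S≥δ (head z) (tail z))
    where
    b = M zero zero
    0<b² = *-positive 0<b 0<b
    0<K : 0# < (δ + δ) + ((R + R) + b * b)
    0<K = <-≤-trans 0<b² $ ≤-respˡ-≈ (trans (+-identityˡ _) (+-identityˡ _)) $
      +-mono-≤ (+-nonNegative (<⇒≤ 0<δ) (<⇒≤ 0<δ)) (+-mono-≤ (+-nonNegative 0≤R 0≤R) ≤-refl)

  singular-or-definite : ∀ {n} (M : Matrix n) → Symmetric M → PositiveSemidefinite M →
                         Singular M ⊎ Definite M
  -- In dimension zero no vector is nonzero, so only definiteness is possible; both sides are empty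
  -- sums and any positive constant will do.
  singular-or-definite {zero} M _ psd = inj₂ (1# , 0<1 , λ z → ≤-reflexive
    (trans (trans (*-identityˡ _) (sum-zero _ (λ ()))) (sym (sum-zero _ (λ ())))))
  singular-or-definite {suc n} M M-sym psd with M zero zero ≈? 0#
  ... | yes b≈0 = inj₁ (zero-corner⇒singular M-sym psd b≈0)
  ... | no  b≉0 = [ inj₁ ∘ schur-singular M-sym 0<b , inj₂ ∘ schur-definite M-sym 0<b ]′
                    (singular-or-definite (schur M) (schur-symmetric M-sym) (schur-psd M-sym psd 0<b))
    where
    0<b : 0# < M zero zero
    0<b = ≤∧≉⇒< (corner-positive psd) (b≉0 ∘ sym)

  -- The matrices μ - M and the largest eigenvalue.

  1ᴹ : ∀ {n} → Matrix n
  1ᴹ a b = if does (a ≟ b) then 1# else 0#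

  1ᴹ-diagonal : ∀ {n} (a : Fin n) → 1ᴹ a a ≈ 1#
  1ᴹ-diagonal a with a ≟ a
  ... | yes _  = refl
  ... | no a≢a = contradiction ≡.refl a≢a

  1ᴹ-off-diagonal : ∀ {n} {a b : Fin n} → a ≢ b → 1ᴹ a b ≈ 0#
  1ᴹ-off-diagonal {a = a} {b} a≢b with a ≟ b
  ... | yes a≡b = contradiction a≡b a≢b
  ... | no _    = refl

  1ᴹ-symmetric : ∀ {n} → Symmetric (1ᴹ {n})
  1ᴹ-symmetric a b with a ≟ b
  ... | yes ≡.refl = sym (1ᴹ-diagonal a)
  ... | no a≢b     = sym (1ᴹ-off-diagonal (a≢b ∘ ≡.sym))

  1ᴹ-· : ∀ {n} (x : Vector Carrier n) a → (1ᴹ · x) a ≈ x a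
  1ᴹ-· x a = begin
    (1ᴹ · x) a
      ≈⟨ sum-single _ a (λ b b≢a → trans (*-congʳ (1ᴹ-off-diagonal (b≢a ∘ ≡.sym))) (zeroˡ _)) ⟩
    1ᴹ a a * x a  ≈⟨ trans (*-congʳ (1ᴹ-diagonal a)) (*-identityˡ _) ⟩
    x a           ∎

  infix 6 _-ᴹ_
  _-ᴹ_ : ∀ {n} → Carrier → Matrix n → Matrix n
  (μ -ᴹ M) a b = μ * 1ᴹ a b - M a b

  -ᴹ-symmetric : ∀ {n μ} {M : Matrix n} → Symmetric M → Symmetric (μ -ᴹ M)
  -ᴹ-symmetric M-sym a b = +-cong (*-congˡ (1ᴹ-symmetric a b)) (-‿cong (M-sym a b))

  -ᴹ-· : ∀ {n} μ (M : Matrix n) x a → ((μ -ᴹ M) · x) a ≈ μ * x a - (M · x) a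
  -ᴹ-· μ M x a = begin
    ((μ -ᴹ M) · x) a
      ≈⟨ sum-cong (λ b → solve 4 (λ μ i m x → (μ :* i :- m) :* x := μ :* (i :* x) :+ :- con (+ 1) :* (m :* x))
                             refl μ (1ᴹ a b) (M a b) (x b)) ⟩
    sum (λ b → μ * (1ᴹ a b * x b) + - 1# * (M a b * x b))  ≈⟨ sum-linear _ _ _ _ ⟩
    μ * (1ᴹ · x) a + - 1# * (M · x) a                      ≈⟨ +-congʳ (*-congˡ (1ᴹ-· x a)) ⟩
    μ * x a + - 1# * (M · x) a
      ≈⟨ solve 2 (λ p q → p :+ :- con (+ 1) :* q := p :- q) refl _ _ ⟩
    μ * x a - (M · x) a                                    ∎

  form--ᴹ : ∀ {n} μ (M : Matrix n) x → form (μ -ᴹ M) x ≈ μ * ⟪ x , x ⟫ - form M x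
  form--ᴹ μ M x = begin
    form (μ -ᴹ M) x                          ≈⟨ ⟪⟫-congʳ x (λ a → trans (-ᴹ-· μ M x a)
                                                  (solve 3 (λ μ x q → μ :* x :- q := μ :* x :+ :- con (+ 1) :* q)
                                                       refl μ (x a) _)) ⟩
    ⟪ x , μ ∙ x ⊕ - 1# ∙ M · x ⟫             ≈⟨ ⟪⟫-linearʳ x μ x (- 1#) (M · x) ⟩
    μ * ⟪ x , x ⟫ + - 1# * form M x
      ≈⟨ solve 2 (λ p q → p :+ :- con (+ 1) :* q := p :- q) refl _ _ ⟩
    μ * ⟪ x , x ⟫ - form M x                 ∎

  form-zero : ∀ {n} (M : Matrix n) {x} → (∀ a → x a ≈ 0#) → form M x ≈ 0#
  form-zero M x≈0 = sum-zero _ λ a → trans (*-congʳ (x≈0 a)) (zeroˡ _)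

  eigen-equation : ∀ {n} {M : Matrix n} {μ x} → IsEigenvector M μ x → ∀ a → (M · x) a ≈ μ * x a
  eigen-equation (_ , Mx≈μx) a = trans (reflexive (sum≡S-sum _)) (Mx≈μx a)

  form-eigenvector : ∀ {n} {M : Matrix n} {μ x} → IsEigenvector M μ x → form M x ≈ μ * ⟪ x , x ⟫
  form-eigenvector {μ = μ} {x} eig = trans (⟪⟫-congʳ x (eigen-equation eig)) (⟪⟫-scaleʳ x μ x)

  -- The supremum of the Rayleigh quotients, cleared of denominators so that the zero vector is no
  -- exception.
  IsLeastFormBound : ∀ {n} → Matrix n → Carrier → Set _
  IsLeastFormBound M s = (∀ x → form M x ≤ s * ⟪ x , x ⟫) ×
                         (∀ t → (∀ x → form M x ≤ t * ⟪ x , x ⟫) → s ≤ t)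

  leastFormBound-eigenvalue : ∀ {n} {M : Matrix n} {s} → Symmetric M →
    IsLeastFormBound M s → IsEigenvalue M s
  leastFormBound-eigenvalue {M = M} {s} M-sym (form≤s , s-least)
    with singular-or-definite (s -ᴹ M) (-ᴹ-symmetric M-sym)
           (λ x → ≤-respʳ-≈ (sym (form--ᴹ s M x)) (x≤y⇒0≤y-x (form≤s x)))
  ... | inj₁ (x , x≉0 , Bx≈0) = x , x≉0 , λ a → begin
      _                               ≡⟨ sum≡S-sum _ ⟨
      (M · x) a                       ≈⟨ solve 2 (λ m q → m := q :- (q :- m)) refl _ _ ⟩
      s * x a - (s * x a - (M · x) a) ≈⟨ +-congˡ (-‿cong (trans (sym (-ᴹ-· s M x a)) (Bx≈0 a))) ⟩
      s * x a - 0#                    ≈⟨ solve 1 (λ q → q :- con (+ 0) := q) refl _ ⟩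
      s * x a                         ∎
  ... | inj₂ (δ , 0<δ , δ≤) = contradiction δ≤0 0<δ
    where
    -- A uniform gap δ below `s` would make s - δ a form bound too, against the minimality of `s`.
    bound : ∀ x → form M x ≤ (s - δ) * ⟪ x , x ⟫
    bound x = 0≤y-x⇒x≤y $ ≤-respʳ-≈
      (trans (+-congʳ (form--ᴹ s M x))
        (solve 4 (λ s q f d → s :* q :- f :- d :* q := (s :- d) :* q :- f)
             refl s ⟪ x , x ⟫ (form M x) δ))
      (x≤y⇒0≤y-x (δ≤ x))
    δ≤0 : δ ≤ 0#
    δ≤0 = 0≤y-x⇒x≤y $ ≤-respʳ-≈
      (solve 2 (λ s d → (s :- d) :- s := con (+ 0) :- d) refl s δ)
      (x≤y⇒0≤y-x (s-least (s - δ) bound))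

  -- Positivity of ⟪x, x⟫ is what cancellation and `reciprocal` take, and compared with `NonZero x`
  -- it brings the type to the universe level that `supremum` asks for.
  RayleighQuotient : ∀ {n} → Matrix n → Carrier → Set (c ⊔ ℓ₁ ⊔ ℓ₂)
  RayleighQuotient M t = ∃ λ x → 0# < ⟪ x , x ⟫ × t * ⟪ x , x ⟫ ≈ form M x

  rayleighQuotient : ∀ {n} (M : Matrix n) {x} → 0# < ⟪ x , x ⟫ →
                     ∃ λ t → RayleighQuotient M t × t * ⟪ x , x ⟫ ≈ form M x
  rayleighQuotient M {x} 0<q with reciprocal 0<q
  ... | i , _ , qi≈1 = form M x * i , (x , 0<q , eq) , eq
    where
    eq : form M x * i * ⟪ x , x ⟫ ≈ form M x
    eq = trans (solve 3 (λ f i q → f :* i :* q := f :* (q :* i)) refl (form M x) i ⟪ x , x ⟫)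
           (trans (*-congˡ qi≈1) (*-identityʳ _))

  quotient≤bound : ∀ {n} {M : Matrix n} {K} → (∀ x → form M x ≤ K * ⟪ x , x ⟫) →
                   ∀ t → RayleighQuotient M t → t ≤ K
  quotient≤bound f≤K t (x , 0<q , tq≈f) =
    *-cancelˡ-≤ 0<q (≤-resp-≈₂ (trans (sym tq≈f) (*-comm _ _)) (*-comm _ _) (f≤K x))

  form≤upperBound : ∀ {n} {M : Matrix n} {s} → (∀ t → RayleighQuotient M t → t ≤ s) →
                    ∀ x → form M x ≤ s * ⟪ x , x ⟫
  form≤upperBound {M = M} {s} quotient≤s x with nonZero? x
  ... | inj₂ x≈0 = ≤-reflexive (trans (form-zero M x≈0)
          (sym (trans (*-congˡ (sum-zero _ λ a → trans (*-congˡ (x≈0 a)) (zeroʳ _))) (zeroʳ s))))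
  ... | inj₁ x≉0 with rayleighQuotient M (⟪x,x⟫-positive x≉0)
  ...   | t , t∈ , tq≈f = ≤-resp-≈₂ (trans (*-comm _ _) tq≈f) (*-comm _ _)
            (*-monoˡ-≤ (⟪x,x⟫-nonNegative x) (quotient≤s t t∈))

  -- The given eigenvalue is itself a quotient and so shows that the set is inhabited, which fails
  -- in dimension zero.
  leastFormBound : ∀ {n} {M : Matrix n} {μ} → IsEigenvalue M μ → ∃ (IsLeastFormBound M)
  leastFormBound {M = M} {μ} (x , eig)
    with supremum (RayleighQuotient M) (μ , x , ⟪x,x⟫-positive (proj₁ eig) , sym (form-eigenvector eig))
           (proj₁ (form-bounded M) , quotient≤bound (proj₂ (form-bounded M)))
  ... | s , upper , least = s , form≤upperBound upper , λ t f≤t → least t (quotient≤bound f≤t)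

  -- The least form bound `s` is an eigenvalue, so s ≤ μ and its bound passes to μ.
  form≤max-eigenvalue : ∀ {n} {M : Matrix n} {μ} → Symmetric M → IsEigenvalue M μ →
    (∀ ν → IsEigenvalue M ν → ν ≤ μ) → ∀ z → form M z ≤ μ * ⟪ z , z ⟫
  form≤max-eigenvalue {M = M} M-sym eig μ-max z with leastFormBound eig
  ... | s , least@(form≤s , _) = ≤-trans (form≤s z)
          (≤-resp-≈₂ (*-comm _ _) (*-comm _ _)
            (*-monoˡ-≤ (⟪x,x⟫-nonNegative z) (μ-max s (leastFormBound-eigenvalue M-sym least))))

-- Edge labels after deletions and additions, and the two sides of a cut edge.

samePair-refl : ∀ {n} (a b : Fin n) → samePair a b a b ≡ true
samePair-refl a b rewrite dec-true (a ≟ a) ≡.refl | dec-true (b ≟ b) ≡.refl = ≡.refl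

samePair-false : ∀ {n} {a b x y : Fin n} → x ≢ a ⊎ y ≢ b → x ≢ b ⊎ y ≢ a → samePair a b x y ≡ false
samePair-false {a = a} {b} {x} {y} p q = ≡.cong₂ _∨_ (both p) (both q)
  where
  both : ∀ {a b} → x ≢ a ⊎ y ≢ b → does (x ≟ a) ∧ does (y ≟ b) ≡ false
  both {a} {b} (inj₁ x≢a) rewrite dec-false (x ≟ a) x≢a = ≡.refl
  both {a} {b} (inj₂ y≢b) rewrite dec-false (y ≟ b) y≢b = ∧-zeroʳ _

samePair-true : ∀ {n} {a b x y : Fin n} → samePair a b x y ≡ true →
                x ≡ a × y ≡ b ⊎ x ≡ b × y ≡ a
samePair-true {a = a} {b} {x} {y} eq with x ≟ a | y ≟ b | x ≟ b | y ≟ a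
... | yes x≡a | yes y≡b | _       | _       = inj₁ (x≡a , y≡b)
... | _       | _       | yes x≡b | yes y≡a = inj₂ (x≡b , y≡a)
samePair-true () | no _ | _ | no _ | _
samePair-true () | no _ | _ | yes _ | no _
samePair-true () | yes _ | no _ | no _ | _
samePair-true () | yes _ | no _ | yes _ | no _

adj⇒≢ : ∀ {n} (Γ : SignedGraph n) {a b} → Adj Γ a b → a ≢ b
adj⇒≢ Γ {a} ab ≡.refl with label Γ a a | label-irrefl Γ a
adj⇒≢ Γ () ≡.refl | nothing | _

¬adj⇒nothing : ∀ {n} (Γ : SignedGraph n) {a b} → ¬ Adj Γ a b → label Γ a b ≡ nothing
¬adj⇒nothing Γ {a} {b} ¬ab with label Γ a b
... | nothing = ≡.refl
... | just _  = contradiction (just tt) ¬ab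

deleteEdge-label : ∀ {n} (Γ : SignedGraph n) {a b} x y → samePair a b x y ≡ false →
                   label (deleteEdge Γ a b) x y ≡ label Γ x y
deleteEdge-label Γ x y eq rewrite eq = ≡.refl

addEdge-label : ∀ {n} (Γ : SignedGraph n) {a b} (a≢b : a ≢ b) τ x y → samePair a b x y ≡ false →
                label (addEdge Γ a b a≢b τ) x y ≡ label Γ x y
addEdge-label Γ a≢b τ x y eq rewrite eq = ≡.refl

-- Applied to the pairs `u`, `w i`: they are still non-edges when the new edges are added after the
-- deletion.
deleteStar-nothing : ∀ {n s} (Γ : SignedGraph n) v (w : Fin s → Fin n) {x y} →
                     label Γ x y ≡ nothing → label (deleteStar Γ v w) x y ≡ nothing
deleteStar-nothing {s = zero}  Γ v w eq = eq
deleteStar-nothing {s = suc _} Γ v w {x} {y} eq = deleteStar-nothing (deleteEdge Γ v (w zero)) v (w ∘ suc) step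
  where
  step : label (deleteEdge Γ v (w zero)) x y ≡ nothing
  step with samePair v (w zero) x y
  ... | true  = ≡.refl
  ... | false = eq

-- If the deletion of ab left a and b connected, then it would change no
-- connected component, so the number of components would not increase.
cutEdge-disconnects : ∀ {n} (Γ : SignedGraph n) {a b} → IsCutEdge Γ a b →
                      ¬ Connected (deleteEdge Γ a b) a b
cutEdge-disconnects {n} Γ {a} {b} (_ , k , k′ , (comp , _ , same) , (comp′ , onto′ , same′) , k<k′) path =
  ℕ.<⇒≱ k<k′ (injective⇒≤ {f = comp ∘ representative} injective)
  where
  Γ′ = deleteEdge Γ a b

  symmetric : ∀ {x y} → Adj Γ′ x y → Adj Γ′ y x
  symmetric {x} {y} = ≡.subst Is-just (label-sym Γ′ x y)

  reconnect : ∀ {x y} → Adj Γ x y → Connected Γ′ x y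
  reconnect {x} {y} xy with samePair a b x y in eq
  ... | false = ≡.subst Is-just (≡.sym (deleteEdge-label Γ x y eq)) xy ◅ ε
  ... | true with samePair-true {a = a} {b} {x} {y} eq
  ...   | inj₁ (≡.refl , ≡.refl) = path
  ...   | inj₂ (≡.refl , ≡.refl) = Star.reverse symmetric path

  representative : Fin k′ → Fin n
  representative i = proj₁ (onto′ i)

  comp′-representative : ∀ i → comp′ (representative i) ≡ i
  comp′-representative i = proj₂ (onto′ i) ≡.refl

  injective : Injective _≡_ _≡_ (comp ∘ representative)
  injective {i} {j} eq = ≡.trans (≡.sym (comp′-representative i)) $ ≡.trans
    (Equivalence.from (same′ _ _) ((reconnect Star.⋆) (Equivalence.to (same _ _) eq)))
    (comp′-representative j)

-- What is used of the vertex set C of the component of w after the deletion of vw.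
record Separates {n} (Γ : SignedGraph n) (v w : Fin n) (C : Fin n → Bool) : Set where
  field
    w∈C      : C w ≡ true
    v∉C      : C v ≡ false
    boundary : ∀ {a b} → C a ≡ true → C b ≡ false → a ≢ w ⊎ b ≢ v → label Γ a b ≡ nothing

-- The component labelling contained in `IsCutEdge` turns membership in the component of `w` into a
-- Boolean test. An edge leaving `C` other than wv survives the deletion and would force equal
-- labels on its ends.
cutEdge-separates : ∀ {n} (Γ : SignedGraph n) {v w} → IsCutEdge Γ v w → ∃ (Separates Γ v w)
cutEdge-separates Γ {v} {w} cut@(_ , _ , _ , _ , (comp , _ , same) , _) = C , record
  { w∈C = dec-true (comp w ≟ comp w) ≡.refl
  ; v∉C = v∉C
  ; boundary = λ {a} {b} → boundary {a} {b}
  }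
  where
  C = λ a → does (comp a ≟ comp w)

  v∉C : C v ≡ false
  v∉C = dec-false (comp v ≟ comp w) (cutEdge-disconnects Γ cut ∘ Equivalence.to (same v w))

  boundary : ∀ {a b} → C a ≡ true → C b ≡ false → a ≢ w ⊎ b ≢ v → label Γ a b ≡ nothing
  boundary {a} {b} a∈C b∉C off = ¬adj⇒nothing Γ λ ab →
    contradiction (≡.trans (≡.sym a∈C) (≡.trans (≡.cong (λ i → does (i ≟ comp w)) (same-comp ab)) b∉C)) λ ()
    where
    a≢v : a ≢ v
    a≢v ≡.refl = contradiction (≡.trans (≡.sym a∈C) v∉C) λ ()
    same-comp : Adj Γ a b → comp a ≡ comp b
    same-comp ab = Equivalence.from (same a b)
      -- `a≢v` rules out that ab is vw in one orientation, `off` in the other.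
      (≡.subst Is-just (≡.sym (deleteEdge-label Γ a b (samePair-false (inj₁ a≢v) off))) ab ◅ ε)

-- The quadratic form of a signed graph when edges change.

module SignedGraphs {c ℓ₁ ℓ₂} (ℝ : CompleteOrderedField c ℓ₁ ℓ₂) where
  open OrderedFieldProperties ℝ
  open LinearAlgebra ℝ
  open Rayleigh ℝ
  open Spectrum ℝ
  open SetoidReasoning setoid

  entry-nothing : ∀ {m} → m ≡ nothing → entry m ≈ 0#
  entry-nothing ≡.refl = refl

  entry-to-witness : ∀ {m} (j : Is-just m) → entry (just (to-witness j)) ≈ entry m
  entry-to-witness (just _) = refl

  entry-cong : ∀ {m m′} → m ≡ m′ → entry m ≈ entry m′
  entry-cong = reflexive ∘ ≡.cong entry

  adjacency-symmetric : ∀ {n} (Γ : SignedGraph n) → Symmetric (adjacencyMatrix Γ)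
  adjacency-symmetric Γ a b = entry-cong (label-sym Γ a b)

  form-difference : ∀ {n} (M M′ : Matrix n) x →
    form M′ x ≈ form M x + form (λ a b → M′ a b - M a b) x
  form-difference M M′ x = begin
    form M′ x
      ≈⟨ ⟪⟫-congʳ x (λ a → sum-cong λ b → solve 3 (λ m m′ x → m′ :* x := m :* x :+ (m′ :- m) :* x)
                                              refl (M a b) (M′ a b) (x b)) ⟩
    ⟪ x , (λ a → sum (λ b → M a b * x b + (M′ a b - M a b) * x b)) ⟫
      ≈⟨ sum-cong (λ a → trans (*-congˡ (sum-distrib-+ _ _)) (distribˡ _ _ _)) ⟩
    sum (λ a → x a * (M · x) a + x a * ((λ a b → M′ a b - M a b) · x) a)
      ≈⟨ sum-distrib-+ _ _ ⟩
    form M x + form (λ a b → M′ a b - M a b) x ∎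

  -- The difference matrix lives on the entries (p, q) and (q, p), equal by symmetry, so the change
  -- is counted twice.
  form-change-pair : ∀ {n} {M M′ : Matrix n} {p q} → Symmetric M → Symmetric M′ → p ≢ q →
    (∀ a b → samePair p q a b ≡ false → M′ a b ≈ M a b) → ∀ x →
    form M′ x ≈ form M x + ((M′ p q - M p q) * (x p * x q) + (M′ p q - M p q) * (x p * x q))
  form-change-pair {M = M} {M′} {p} {q} M-sym M′-sym p≢q unchanged x =
    trans (form-difference M M′ x) $ +-congˡ $ begin
      form E x                            ≈⟨ sum-pair _ p≢q row-zero ⟩
      x p * (E · x) p + x q * (E · x) q   ≈⟨ +-cong (*-congˡ row-p) (*-congˡ row-q) ⟩
      x p * (E p q * x q) + x q * (E q p * x p)
        ≈⟨ +-congˡ (*-congˡ (*-congʳ (+-cong (M′-sym q p) (-‿cong (M-sym q p))))) ⟩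
      x p * (E p q * x q) + x q * (E p q * x p)
        ≈⟨ solve 3 (λ e s t → s :* (e :* t) :+ t :* (e :* s) := e :* (s :* t) :+ e :* (s :* t))
               refl (E p q) (x p) (x q) ⟩
      E p q * (x p * x q) + E p q * (x p * x q) ∎
    where
    E : Matrix _
    E a b = M′ a b - M a b

    E≈0 : ∀ a b → samePair p q a b ≡ false → E a b * x b ≈ 0#
    E≈0 a b eq = trans (*-congʳ (trans (+-congʳ (unchanged a b eq)) (-‿inverseʳ _))) (zeroˡ _)

    row-zero : ∀ a → a ≢ p → a ≢ q → x a * (E · x) a ≈ 0#
    row-zero a a≢p a≢q = trans
      (*-congˡ (sum-zero _ λ b → E≈0 a b (samePair-false {y = b} (inj₁ a≢p) (inj₁ a≢q)))) (zeroʳ _)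

    row-p : (E · x) p ≈ E p q * x q
    row-p = sum-single _ q λ b b≢q → E≈0 p b (samePair-false (inj₂ b≢q) (inj₁ p≢q))

    row-q : (E · x) q ≈ E q p * x p
    row-q = sum-single _ p λ b b≢p → E≈0 q b (samePair-false (inj₁ (p≢q ∘ ≡.sym)) (inj₂ b≢p))

  -- The removed terms are added back on the left, so that the forms before and after moving both
  -- become the form of the star-deleted graph plus a sum.
  form-deleteEdge : ∀ {n} (Γ : SignedGraph n) {p q} → p ≢ q → ∀ x →
    let e = adjacencyMatrix Γ p q * (x p * x q) in
    form (adjacencyMatrix (deleteEdge Γ p q)) x + (e + e) ≈ form (adjacencyMatrix Γ) x
  form-deleteEdge Γ {p} {q} p≢q x = begin
    form A′ x + (A p q * X + A p q * X)
      ≈⟨ +-congʳ (form-change-pair (adjacency-symmetric Γ) (adjacency-symmetric (deleteEdge Γ p q)) p≢q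
           (λ a b eq → entry-cong (deleteEdge-label Γ a b eq)) x) ⟩
    form A x + ((A′ p q - A p q) * X + (A′ p q - A p q) * X) + (A p q * X + A p q * X)
      ≈⟨ solve 4 (λ f m′ m X → f :+ ((m′ :- m) :* X :+ (m′ :- m) :* X) :+ (m :* X :+ m :* X) := f :+ m′ :* (X :+ X))
             refl (form A x) (A′ p q) (A p q) X ⟩
    form A x + A′ p q * (X + X)
      ≈⟨ +-congˡ (trans (*-congʳ (entry-nothing deleted)) (zeroˡ _)) ⟩
    form A x + 0#
      ≈⟨ +-identityʳ _ ⟩
    form A x ∎
    where
    A = adjacencyMatrix Γ
    A′ = adjacencyMatrix (deleteEdge Γ p q)
    X = x p * x q
    deleted : label (deleteEdge Γ p q) p q ≡ nothing
    deleted rewrite samePair-refl p q = ≡.refl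

  form-addEdge : ∀ {n} (Γ : SignedGraph n) {p q} (p≢q : p ≢ q) τ → label Γ p q ≡ nothing → ∀ x →
    let e = entry (just τ) * (x p * x q) in
    form (adjacencyMatrix (addEdge Γ p q p≢q τ)) x ≈ form (adjacencyMatrix Γ) x + (e + e)
  form-addEdge Γ {p} {q} p≢q τ nonedge x = begin
    form A′ x
      ≈⟨ form-change-pair (adjacency-symmetric Γ) (adjacency-symmetric (addEdge Γ p q p≢q τ)) p≢q
           (λ a b eq → entry-cong (addEdge-label Γ p≢q τ a b eq)) x ⟩
    form A x + ((A′ p q - A p q) * X + (A′ p q - A p q) * X)
      ≈⟨ +-congˡ (+-cong (*-congʳ new) (*-congʳ new)) ⟩
    form A x + (entry (just τ) * X + entry (just τ) * X) ∎
    where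
    A = adjacencyMatrix Γ
    A′ = adjacencyMatrix (addEdge Γ p q p≢q τ)
    X = x p * x q
    added : label (addEdge Γ p q p≢q τ) p q ≡ just τ
    added rewrite samePair-refl p q = ≡.refl
    new : A′ p q - A p q ≈ entry (just τ)
    new = begin
      A′ p q - A p q         ≈⟨ +-cong (entry-cong added) (-‿cong (entry-nothing nonedge)) ⟩
      entry (just τ) - 0#    ≈⟨ solve 1 (λ e → e :- con (+ 0) := e) refl _ ⟩
      entry (just τ)         ∎

  -- Injectivity of `w` keeps the labels of the remaining star edges intact at each deletion, so
  -- every summand can be read off in the original Γ.
  form-deleteStar : ∀ {n s} (Γ : SignedGraph n) v (w : Fin s → Fin n) → Injective _≡_ _≡_ w →
    (∀ i → v ≢ w i) → ∀ x →
    let e = λ i → adjacencyMatrix Γ v (w i) * (x v * x (w i)) in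
    form (adjacencyMatrix (deleteStar Γ v w)) x + sum (λ i → e i + e i) ≈ form (adjacencyMatrix Γ) x
  form-deleteStar {s = zero} Γ v w w-inj v≢w x = trans (+-congˡ (sum-zero _ (λ ()))) (+-identityʳ _)
  form-deleteStar {s = suc s} Γ v w w-inj v≢w x = begin
    f + sum (λ i → e i + e i)
      ≈⟨ +-congˡ (sum-suc _) ⟩
    f + (e zero + e zero + sum (λ i → e (suc i) + e (suc i)))
      ≈⟨ solve 3 (λ f e r → f :+ (e :+ r) := f :+ r :+ e) refl f (e zero + e zero) _ ⟩
    f + sum (λ i → e (suc i) + e (suc i)) + (e zero + e zero)
      ≈⟨ +-congʳ (+-congˡ (sum-cong λ i → let eq = *-congʳ (entry-cong (≡.sym (others i))) in +-cong eq eq)) ⟩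
    f + sum (λ i → e′ i + e′ i) + (e zero + e zero)
      ≈⟨ +-congʳ (form-deleteStar Γ′ v (w ∘ suc) (suc-injective ∘ w-inj) (v≢w ∘ suc) x) ⟩
    form (adjacencyMatrix Γ′) x + (e zero + e zero)
      ≈⟨ form-deleteEdge Γ (v≢w zero) x ⟩
    form (adjacencyMatrix Γ) x ∎
    where
    Γ′ = deleteEdge Γ v (w zero)
    f = form (adjacencyMatrix (deleteStar Γ′ v (w ∘ suc))) x
    e : Fin (suc s) → Carrier
    e i = adjacencyMatrix Γ v (w i) * (x v * x (w i))
    e′ : Fin s → Carrier
    e′ i = adjacencyMatrix Γ′ v (w (suc i)) * (x v * x (w (suc i)))
    others : ∀ i → label Γ′ v (w (suc i)) ≡ label Γ v (w (suc i))
    others i = deleteEdge-label Γ v (w (suc i)) $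
      samePair-false (inj₂ (λ eq → contradiction (w-inj eq) λ ())) (inj₁ (v≢w zero))

  -- Injectivity of `w` ensures that a pair still to be joined has not been joined by an earlier
  -- addition.
  form-addStar : ∀ {n s} (Γ : SignedGraph n) u (w : Fin s → Fin n) (u≢w : ∀ i → u ≢ w i) τ →
    Injective _≡_ _≡_ w → (∀ i → label Γ u (w i) ≡ nothing) → ∀ x →
    let e = λ i → entry (just (τ i)) * (x u * x (w i)) in
    form (adjacencyMatrix (addStar Γ u w u≢w τ)) x ≈ form (adjacencyMatrix Γ) x + sum (λ i → e i + e i)
  form-addStar {s = zero} Γ u w u≢w τ w-inj nonedge x =
    sym (trans (+-congˡ (sum-zero _ (λ ()))) (+-identityʳ _))
  form-addStar {s = suc s} Γ u w u≢w τ w-inj nonedge x = begin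
    form (adjacencyMatrix (addStar Γ′ u (w ∘ suc) (u≢w ∘ suc) (τ ∘ suc))) x
      ≈⟨ form-addStar Γ′ u (w ∘ suc) (u≢w ∘ suc) (τ ∘ suc) (suc-injective ∘ w-inj) nonedge′ x ⟩
    form (adjacencyMatrix Γ′) x + sum (λ i → e (suc i) + e (suc i))
      ≈⟨ +-congʳ (form-addEdge Γ (u≢w zero) (τ zero) (nonedge zero) x) ⟩
    form (adjacencyMatrix Γ) x + (e zero + e zero) + sum (λ i → e (suc i) + e (suc i))
      ≈⟨ +-assoc _ _ _ ⟩
    form (adjacencyMatrix Γ) x + (e zero + e zero + sum (λ i → e (suc i) + e (suc i)))
      ≈⟨ +-congˡ (sum-suc _) ⟨
    form (adjacencyMatrix Γ) x + sum (λ i → e i + e i) ∎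
    where
    Γ′ = addEdge Γ u (w zero) (u≢w zero) (τ zero)
    e : Fin (suc s) → Carrier
    e i = entry (just (τ i)) * (x u * x (w i))
    nonedge′ : ∀ i → label Γ′ u (w (suc i)) ≡ nothing
    nonedge′ i = ≡.trans
      (addEdge-label Γ (u≢w zero) (τ zero) u (w (suc i)) $
        samePair-false (inj₂ (λ eq → contradiction (w-inj eq) λ ())) (inj₁ (u≢w zero)))
      (nonedge (suc i))

  -- Restricting an eigenvector to one side of a cut edge.

  restrict : ∀ {n} → (Fin n → Bool) → Vector Carrier n → Vector Carrier n
  restrict C x a = if C a then x a else 0#

  restrict-in : ∀ {n} (C : Fin n → Bool) x {a} → C a ≡ true → restrict C x a ≈ x a
  restrict-in C x a∈C rewrite a∈C = refl

  restrict-out : ∀ {n} (C : Fin n → Bool) x {a} → C a ≡ false → restrict C x a ≈ 0#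
  restrict-out C x a∉C rewrite a∉C = refl

  module _ {n} {A : Matrix n} {μ} {x : Vector Carrier n} {v w : Fin n} (C : Fin n → Bool)
    (A-sym : Symmetric A) (eigen : ∀ a → (A · x) a ≈ μ * x a)
    (w∈C : C w ≡ true) (v∉C : C v ≡ false)
    (boundary : ∀ {a b} → C a ≡ true → C b ≡ false → a ≢ w ⊎ b ≢ v → A a b ≈ 0#)
    where

    private
      y : Vector Carrier n
      y = restrict C x

    -- Inside `C` the term μ y a equals μ x a = (A x) a, so the residual only sees the part of `x`
    -- that was cut away.
    residual-inside : ∀ {a} → C a ≡ true →
      ((μ -ᴹ A) · y) a ≈ sum (λ b → A a b * (x b - y b))
    residual-inside {a} a∈C = begin
      ((μ -ᴹ A) · y) a            ≈⟨ -ᴹ-· μ A y a ⟩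
      μ * y a - (A · y) a         ≈⟨ +-congʳ (trans (*-congˡ (restrict-in C x a∈C)) (sym (eigen a))) ⟩
      (A · x) a - (A · y) a
        ≈⟨ solve 2 (λ p q → p :- q := con (+ 1) :* p :+ :- con (+ 1) :* q) refl _ _ ⟩
      1# * (A · x) a + - 1# * (A · y) a   ≈⟨ sum-linear _ _ _ _ ⟨
      sum (λ b → 1# * (A a b * x b) + - 1# * (A a b * y b))
        ≈⟨ sum-cong (λ b → solve 3 (λ m x y → con (+ 1) :* (m :* x) :+ :- con (+ 1) :* (m :* y) := m :* (x :- y))
                               refl (A a b) (x b) (y b)) ⟩
      sum (λ b → A a b * (x b - y b)) ∎

    crossing : ∀ {a b} → C a ≡ true → a ≢ w ⊎ b ≢ v → A a b * (x b - y b) ≈ 0#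
    crossing {a} {b} a∈C off = cases (C b) ≡.refl
      where
      cases : ∀ t → C b ≡ t → A a b * (x b - y b) ≈ 0#
      cases true b∈C = trans (*-congˡ (trans (+-congˡ (-‿cong (restrict-in C x b∈C))) (-‿inverseʳ _))) (zeroʳ _)
      cases false b∉C = trans (*-congʳ (boundary a∈C b∉C off)) (zeroˡ _)

    residual-w : ((μ -ᴹ A) · y) w ≈ A w v * x v
    residual-w = begin
      ((μ -ᴹ A) · y) w                   ≈⟨ residual-inside w∈C ⟩
      sum (λ b → A w b * (x b - y b))    ≈⟨ sum-single _ v (λ b b≢v → crossing w∈C (inj₂ b≢v)) ⟩
      A w v * (x v - y v)                ≈⟨ *-congˡ (+-congˡ (-‿cong (restrict-out C x v∉C))) ⟩
      A w v * (x v - 0#)                 ≈⟨ *-congˡ (solve 1 (λ t → t :- con (+ 0) := t) refl _) ⟩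
      A w v * x v                        ∎

    -- Off `C` the factor `y` vanishes, and inside `C` the residual does so except at `w`, the only
    -- vertex with a neighbour outside.
    form-restrict : form (μ -ᴹ A) y ≈ A v w * x w * x v
    form-restrict = begin
      form (μ -ᴹ A) y              ≈⟨ sum-single _ w elsewhere ⟩
      y w * ((μ -ᴹ A) · y) w
        ≈⟨ *-cong (restrict-in C x w∈C) (trans residual-w (*-congʳ (A-sym w v))) ⟩
      x w * (A v w * x v)
        ≈⟨ solve 3 (λ s m t → s :* (m :* t) := m :* s :* t) refl (x w) (A v w) (x v) ⟩
      A v w * x w * x v            ∎
      where
      elsewhere : ∀ a → a ≢ w → y a * ((μ -ᴹ A) · y) a ≈ 0#
      elsewhere a a≢w = cases (C a) ≡.refl
        where
        cases : ∀ t → C a ≡ t → y a * ((μ -ᴹ A) · y) a ≈ 0#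
        cases true a∈C = trans (*-congˡ (trans (residual-inside a∈C) (sum-zero _ λ b → crossing a∈C (inj₁ a≢w)))) (zeroʳ _)
        cases false a∉C = trans (*-congʳ (restrict-out C x a∉C)) (zeroˡ _)

    residual-v : ((μ -ᴹ A) · y) v ≈ - (A v w * x w)
    residual-v = begin
      ((μ -ᴹ A) · y) v        ≈⟨ -ᴹ-· μ A y v ⟩
      μ * y v - (A · y) v
        ≈⟨ +-cong (trans (*-congˡ (restrict-out C x v∉C)) (zeroʳ μ)) (-‿cong (sum-single _ w elsewhere)) ⟩
      0# - A v w * y w        ≈⟨ +-identityˡ _ ⟩
      - (A v w * y w)         ≈⟨ -‿cong (*-congˡ (restrict-in C x w∈C)) ⟩
      - (A v w * x w)         ∎
      where
      elsewhere : ∀ b → b ≢ w → A v b * y b ≈ 0#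
      elsewhere b b≢w = cases (C b) ≡.refl
        where
        cases : ∀ t → C b ≡ t → A v b * y b ≈ 0#
        cases true b∈C = trans (*-congʳ (trans (A-sym v b) (boundary b∈C v∉C (inj₁ b≢w)))) (zeroˡ _)
        cases false b∉C = trans (*-congˡ (restrict-out C x b∉C)) (zeroʳ _)

    -- The row `1ᴹ v` serves as the basis vector at `v`. The cross term is the residual of `y` at
    -- `v`, which is -p.
    form-perturbed : A v v ≈ 0# → ∀ κ η → let p = A v w * x w in
      form (μ -ᴹ A) (κ ∙ y ⊕ η ∙ 1ᴹ v) ≈ κ * κ * (p * x v) + (κ * η + κ * η) * - p + η * η * μ
    form-perturbed Avv≈0 κ η = trans (form-combination (-ᴹ-symmetric A-sym) κ y η (1ᴹ v))
      (+-cong (+-cong (*-congˡ form-restrict) (*-congˡ (trans (1ᴹ-· _ v) residual-v))) (*-congˡ diagonal-entry))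
      where
      diagonal-entry : form (μ -ᴹ A) (1ᴹ v) ≈ μ
      diagonal-entry = begin
        form (μ -ᴹ A) (1ᴹ v)             ≈⟨ 1ᴹ-· _ v ⟩
        ((μ -ᴹ A) · 1ᴹ v) v              ≈⟨ ⟪⟫-comm _ (1ᴹ v) ⟩
        (1ᴹ · (μ -ᴹ A) v) v              ≈⟨ 1ᴹ-· _ v ⟩
        μ * 1ᴹ v v - A v v               ≈⟨ +-cong (*-congˡ (1ᴹ-diagonal v)) (-‿cong Avv≈0) ⟩
        μ * 1# - 0#                      ≈⟨ solve 1 (λ m → m :* con (+ 1) :- con (+ 0) := m) refl μ ⟩
        μ                                ∎

    cut-nonNegative : PositiveSemidefinite (μ -ᴹ A) → 0# ≤ A v w * x w * x v
    cut-nonNegative psd = ≤-respʳ-≈ form-restrict (psd y)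

    -- When x v = 0 the form vanishes at `y`, so the linear term of a perturbation towards `v` must
    -- vanish too. The usual limit argument is replaced by one explicit perturbation with a negative
    -- value.
    cut-vanishing : A v v ≈ 0# → PositiveSemidefinite (μ -ᴹ A) → x v ≈ 0# → A v w * x w ≈ 0#
    cut-vanishing Avv≈0 psd xv≈0 with A v w * x w ≈? 0#
    ... | yes p≈0 = p≈0
    ... | no  p≉0 = contradiction (0≤y-x⇒x≤y (≤-respʳ-≈ value (psd _))) (*-positive 0<p² 0<μ+2)
      where
      p = A v w * x w
      -- The coefficients 0 and 1 leave the form at the basis vector alone; the zero diagonal makes
      -- its value μ.
      0≤μ : 0# ≤ μ
      0≤μ = ≤-respʳ-≈ (trans (form-perturbed Avv≈0 0# 1#)
        (solve 3 (λ q p m → con (+ 0) :* con (+ 0) :* q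
                            :+ (con (+ 0) :* con (+ 1) :+ con (+ 0) :* con (+ 1)) :* (:- p)
                            :+ con (+ 1) :* con (+ 1) :* m := m) refl (p * x v) p μ))
        (psd (0# ∙ y ⊕ 1# ∙ 1ᴹ v))
      0<p² : 0# < p * p
      0<p² = ≤∧≉⇒< (square-nonNegative p) (*-nonZero p≉0 p≉0 ∘ sym)
      0<μ+2 : 0# < 1# + (1# + μ)
      0<μ+2 = <-≤-trans 0<1 $ ≤-respˡ-≈ (+-identityʳ 1#) $ +-monoʳ-≤ 1# (+-nonNegative 0≤1 0≤μ)
      -- With x v = 0 the form is -2κηp + η²μ. Taking κ = 1 + μ and η = p gives -p²(2 + μ), negative
      -- without any division by μ.
      value : form (μ -ᴹ A) ((1# + μ) ∙ y ⊕ p ∙ 1ᴹ v) ≈ 0# - p * p * (1# + (1# + μ))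
      value = begin
        _ ≈⟨ form-perturbed Avv≈0 (1# + μ) p ⟩
        (1# + μ) * (1# + μ) * (p * x v) + ((1# + μ) * p + (1# + μ) * p) * - p + p * p * μ
          ≈⟨ +-congʳ (+-congʳ (*-congˡ (*-congˡ xv≈0))) ⟩
        (1# + μ) * (1# + μ) * (p * 0#) + ((1# + μ) * p + (1# + μ) * p) * - p + p * p * μ
          ≈⟨ solve 2 (λ m p → (con (+ 1) :+ m) :* (con (+ 1) :+ m) :* (p :* con (+ 0))
                              :+ ((con (+ 1) :+ m) :* p :+ (con (+ 1) :+ m) :* p) :* (:- p) :+ p :* p :* m
                              := con (+ 0) :- p :* p :* (con (+ 1) :+ (con (+ 1) :+ m))) refl μ p ⟩
        0# - p * p * (1# + (1# + μ)) ∎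

  -- Comparing the two quadratic forms and the two indices.

  shift-nonNegative : ∀ {p s t} → 0# ≤ p * s → (s ≈ 0# → p ≈ 0#) →
    (s ≤ t × 0# ≤ s) ⊎ (t ≤ s × s ≤ 0#) → p * s ≤ p * t
  shift-nonNegative {p} {s} {t} 0≤ps vanish order with s ≈? 0#
  -- Here `t` is not controlled in size, but p = 0 makes both products zero.
  ... | yes s≈0 = ≤-reflexive (trans (p*≈0 s) (sym (p*≈0 t)))
    where
    p*≈0 : ∀ r → p * r ≈ 0#
    p*≈0 r = trans (*-congʳ (vanish s≈0)) (zeroˡ r)
  shift-nonNegative {p} {s} {t} 0≤ps vanish (inj₁ (s≤t , 0≤s)) | no s≉0 =
    *-monoˡ-≤ (*-cancelˡ-nonNegative (≤∧≉⇒< 0≤s (s≉0 ∘ sym)) (≤-respʳ-≈ (*-comm p s) 0≤ps)) s≤t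
  shift-nonNegative {p} {s} {t} 0≤ps vanish (inj₂ (t≤s , s≤0)) | no s≉0 =
    -- A negative `s` turns p s ≥ 0 into p ≤ 0, and t - s ≤ 0 as well, so their product is
    -- nonnegative.
    0≤y-x⇒x≤y $ ≤-respʳ-≈ (solve 3 (λ p s t → :- p :* (s :- t) := p :* t :- p :* s) refl p s t) $
      *-nonNegative 0≤-p (x≤y⇒0≤y-x t≤s)
    where
    0<-s : 0# < - s
    0<-s = ≤∧≉⇒< (neg-nonNegative s≤0) λ 0≈-s → s≉0 $ begin
      s         ≈⟨ solve 1 (λ s → s := :- (:- s)) refl s ⟩
      - (- s)   ≈⟨ -‿cong 0≈-s ⟨
      - 0#      ≈⟨ -0#≈0# ⟩
      0#        ∎
    0≤-p : 0# ≤ - p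
    0≤-p = *-cancelˡ-nonNegative 0<-s
      (≤-respʳ-≈ (solve 2 (λ p s → p :* s := :- s :* :- p) refl p s) 0≤ps)

  index-psd : ∀ {n} (Γ : SignedGraph n) {μ} → IsIndex Γ μ → PositiveSemidefinite (μ -ᴹ adjacencyMatrix Γ)
  index-psd Γ {μ} (eig , max) z = ≤-respʳ-≈ (sym (form--ᴹ μ _ z))
    (x≤y⇒0≤y-x (form≤max-eigenvalue (adjacency-symmetric Γ) eig max z))

  cutEdge-shift : ∀ {n} (Γ : SignedGraph n) {u v w μ x} → IsCutEdge Γ v w → IsIndex Γ μ →
    IsEigenvector (adjacencyMatrix Γ) μ x →
    (x v ≤ x u × 0# ≤ x v) ⊎ (x u ≤ x v × x v ≤ 0#) →
    adjacencyMatrix Γ v w * x w * x v ≤ adjacencyMatrix Γ v w * x w * x u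
  cutEdge-shift Γ {v = v} cut index eig order with cutEdge-separates Γ cut
  ... | C , separates = shift-nonNegative
    (cut-nonNegative C A-sym (eigen-equation eig) w∈C v∉C boundary′ psd)
    (cut-vanishing C A-sym (eigen-equation eig) w∈C v∉C boundary′ (entry-nothing (label-irrefl Γ v)) psd)
    order
    where
    open Separates separates
    A-sym = adjacency-symmetric Γ
    psd = index-psd Γ index
    boundary′ : ∀ {a b} → C a ≡ true → C b ≡ false → _ → adjacencyMatrix Γ a b ≈ 0#
    boundary′ a∈C b∉C off = entry-nothing (boundary a∈C b∉C off)

  -- Both forms are that of the star-deleted graph plus a sum over the moved edges, so the
  -- comparison is termwise. The inherited sign gives the new edge the coefficient `A v (w i)` of
  -- the old one.
  form-moveEdges : ∀ {n s} (Γ : SignedGraph n) {u v} (w : Fin s → Fin n) → Injective _≡_ _≡_ w →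
    (u≢w : ∀ i → u ≢ w i) (vw : ∀ i → Adj Γ v (w i)) → (∀ i → ¬ Adj Γ u (w i)) →
    ∀ {x} → (∀ i → adjacencyMatrix Γ v (w i) * x (w i) * x v ≤ adjacencyMatrix Γ v (w i) * x (w i) * x u) →
    form (adjacencyMatrix Γ) x ≤ form (adjacencyMatrix (moveEdges Γ u v w u≢w vw)) x
  form-moveEdges Γ {u} {v} w w-inj u≢w vw nonadj {x} shift = ≤-resp-≈₂
    (form-deleteStar Γ v w w-inj (λ i → adj⇒≢ Γ (vw i)) x)
    (sym (form-addStar (deleteStar Γ v w) u w u≢w _ w-inj
      (λ i → deleteStar-nothing Γ v w (¬adj⇒nothing Γ (nonadj i))) x))
    (+-monoʳ-≤ _ (sum-mono-≤ λ i → +-mono-≤ (term i) (term i)))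
    where
    A = adjacencyMatrix Γ
    term : ∀ i → A v (w i) * (x v * x (w i)) ≤ entry (just (sign Γ (vw i))) * (x u * x (w i))
    term i = ≤-resp-≈₂
      (solve 3 (λ m s t → m :* t :* s := m :* (s :* t)) refl (A v (w i)) (x v) (x (w i)))
      (trans (solve 3 (λ m s t → m :* t :* s := m :* (s :* t)) refl (A v (w i)) (x u) (x (w i)))
        (*-congʳ (sym (entry-to-witness (vw i)))))
      (shift i)

  -- The eigenvector of Γ is a test vector for Γ′: μ⟪x, x⟫ is its form in Γ, at most its form in Γ′,
  -- hence at most μ′⟪x, x⟫, and ⟪x, x⟫ > 0 cancels.
  index-mono : ∀ {n} (Γ Γ′ : SignedGraph n) {μ μ′ x} → IsEigenvector (adjacencyMatrix Γ) μ x →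
    IsIndex Γ′ μ′ → form (adjacencyMatrix Γ) x ≤ form (adjacencyMatrix Γ′) x → μ ≤ μ′
  index-mono Γ Γ′ {x = x} eig (eig′ , max′) form≤ = *-cancelˡ-≤ (⟪x,x⟫-positive (proj₁ eig)) $
    ≤-resp-≈₂ (trans (form-eigenvector eig) (*-comm _ _)) (*-comm _ _) $
    ≤-trans form≤ (form≤max-eigenvalue (adjacency-symmetric Γ′) eig′ max′ x)

lemma2p3 : ∀ {c ℓ₁ ℓ₂} (ℝ : CompleteOrderedField c ℓ₁ ℓ₂) →
    let open CompleteOrderedField ℝ
        open Spectrum ℝ in
    ∀ {n : ℕ} (Γ : SignedGraph n) (u v : Fin n) → u ≢ v →
    ∀ {s : ℕ} → 1 ≤ᴺ s →
    (w : Fin s → Fin n) → Injective _≡_ _≡_ w →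
    (cut : ∀ i → IsCutEdge Γ v (w i)) →
    (u≢w : ∀ i → u ≢ w i) →
    (∀ i → ¬ Adj Γ u (w i)) →
    (index : Carrier) → IsIndex Γ index →
    (x : Vector Carrier n) → IsEigenvector (adjacencyMatrix Γ) index x →
    ((x v ≤ x u) × (0# ≤ x v)) ⊎ ((x u ≤ x v) × (x v ≤ 0#)) →
    (index′ : Carrier) →
    IsIndex (moveEdges Γ u v w u≢w (λ i → proj₁ (cut i))) index′ →
    index ≤ index′
lemma2p3 ℝ Γ u v _ _ w w-inj cut u≢w nonadj index isIndex x eig order index′ isIndex′ =
  index-mono Γ (moveEdges Γ u v w u≢w vw) eig isIndex′
    (form-moveEdges Γ w w-inj u≢w vw nonadj λ i → cutEdge-shift Γ {u = u} (cut i) isIndex eig order)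
  where
  open SignedGraphs ℝ
  vw : ∀ i → Adj Γ v (w i)
  vw i = proj₁ (cut i)
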